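{- Let $k,m\in\frac12\mathbb{Z}$ and let $\omega$ be a multiplier system of weight $k$ (and index $m$) on $\Gamma(1)^J$ with $\omega([-I,(0,0)])=1$. Let $f:\mathcal{H}\times\mathbb{C}\to\mathbb{C}$ be a Jacobi integral of weight $k$ and index $m$ with multiplier system $\omega$ on $\Gamma(1)^J$, with period functions $P_\gamma$ ($\gamma\in\Gamma(1)^J$), satisfying $P_{[S,(0,0)]}=0$. Suppose $f$ is even and periodic with respect to $z$, i.e. $P_{[-I,(0,0)]}=0$ and $P_{[I,(0,1)]}=0$. Write $h:=P_{[I,(1,0)]}$. Then: (1) $P_{[T,(1,0)]}=P_{[T,(0,0)]}$; (2) $P_{[T,(0,0)]}+P_{[T,(0,0)]}|_{\omega,k,m}[T,(0,0)]=0$; (3) $P_{[T,(0,0)]}+P_{[T,(0,0)]}|_{\omega,k,m}[ST,(0,0)]+P_{[T,(0,0)]}|_{\omega,k,m}[(ST)^2,(0,0)]=0$; (4) $h|_{\omega,k,m}[T,(0,0)]=-P_{[T,(0,0)]}+P_{[T,(0,0)]}|_{\omega,k,m}[I,(0,-1)]$; (5) $h=P_{[T,(0,0)]}-P_{[T,(0,0)]}|_{\omega,k,m}[-I,(1,0)]$; (6) $h+h|_{\omega,k,m}[-I,(1,0)]=0$.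
   Context: $\mathcal{H}$ is the upper half plane; $\tau\in\mathcal{H}$, $z\in\mathbb{C}$, $v=\mathrm{Im}(\tau)$, $y=\mathrm{Im}(z)$. $S=\left(\begin{smallmatrix}1&1\\0&1\end{smallmatrix}\right)$, $T=\left(\begin{smallmatrix}0&-1\\1&0\end{smallmatrix}\right)$, $I$ is the $2\times2$ identity matrix. Jacobi group: $\Gamma(1)^J=\{[M,(\lambda,\mu)]: M\in SL_2(\mathbb{Z}),\ \lambda,\mu\in\mathbb{Z}\}$ with product $[M_1,(\lambda_1,\mu_1)][M_2,(\lambda_2,\mu_2)]=[M_1M_2,(\lambda_1,\mu_1)M_2+(\lambda_2,\mu_2)]$ (row vector times matrix). It acts on $\mathcal{H}\times\mathbb{C}$ by $\gamma(\tau,z)=\left(\frac{a\tau+b}{c\tau+d},\frac{z+\lambda\tau+\mu}{c\tau+d}\right)$ for $\gamma=[\left(\begin{smallmatrix}a&b\\c&d\end{smallmatrix}\right),(\lambda,\mu)]$. Automorphy factor: $j_{k,m}(\gamma,(\tau,z))=(c\tau+d)^{ -k}\exp\left(2\pi i m\left(-\frac{c(z+\lambda\tau+\mu)^2}{c\tau+d}+\lambda^2\tau+2\lambda z+\lambda\mu\right)\right)$ (a fixed branch of the power is used). A multiplier system $\omega$ of weight $k$ (and index $m$) is a function $\omega:\Gamma(1)^J\to\mathbb{C}^*$ with $\omega(\gamma_1\gamma_2)j_{k,m}(\gamma_1\gamma_2,(\tau,z))=\omega(\gamma_1)\omega(\gamma_2)j_{k,m}(\gamma_1,\gamma_2(\tau,z))j_{k,m}(\gamma_2,(\tau,z))$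 for all $\gamma_1,\gamma_2$. Slash operator: $(f|_{\omega,k,m}\gamma)(\tau,z)=\omega(\gamma)j_{k,m}(\gamma,(\tau,z))f(\gamma(\tau,z))$. $\mathcal{P}_m$ is the space of functions $f$ holomorphic on $\mathcal{H}\times\mathbb{C}$ for which there are positive constants $K,\rho,\sigma$ with $|f(\tau,z)|<K(|\tau|^\rho+v^{ -\sigma})e^{2\pi m y^2/v}$. A Jacobi integral of weight $k$, index $m$ and multiplier system $\omega$ on $\Gamma(1)^J$ is a real analytic function $f:\mathcal{H}\times\mathbb{C}\to\mathbb{C}$ such that: (i) for every $\gamma\in\Gamma(1)^J$, $f|_{\omega,k,m}\gamma=f+P_\gamma$ with $P_\gamma\in\mathcal{P}_m$ (the $P_\gamma$ are the period functions of $f$); (ii) $f$ is periodic: $P_{[I,(0,1)]}=0$ and $P_{[S^\ell,(0,0)]}=0$ for some $\ell\in\mathbb{Z}$; (iii) $|f(\tau,z)|v^{ -k/2}e^{2\pi m y^2/v}\to0$ as $v,y\to\infty$. -}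

module Defs where

open import Algebra.Apartness.Bundles using (HeytingField)
open import Algebra.Bundles using (CommutativeRing)
import Algebra.Properties.Ring
import Algebra.Properties.Semiring.Exp
import Algebra.Properties.Semiring.Mult.TCOptimised
import Algebra.Solver.Ring
open import Algebra.Solver.Ring.AlmostCommutativeRing
  using (_-Raw-AlmostCommutative⟶_; fromCommutativeRing; Induced-equivalence)
open import Data.Empty using (⊥; ⊥-elim)
open import Data.Integer.Base as ℤ using (ℤ; +_; -[1+_]; 0ℤ; 1ℤ; -1ℤ)
import Data.Integer.Properties as ℤ
open import Data.Integer.Tactic.RingSolver using (solve-∀)
open import Data.List.Base using (List; foldr; map)
open import Data.List.Relation.Binary.Subset.Propositional using (_⊆_)
open import Data.List.Relation.Unary.Unique.Propositional using (Unique)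
open import Data.Maybe.Base using (just; nothing)
open import Data.Nat.Base as ℕ using (ℕ; zero; suc)
import Data.Nat.Properties as ℕ
open import Data.Product.Relation.Binary.Pointwise.NonDependent using (×-setoid)
open import Data.Product.Base using (∃; _×_; _,_; proj₁; proj₂)
import Data.Sign.Base as Sign
open import Data.Sum.Base using (_⊎_; inj₁; inj₂)
open import Function.Bundles using (Func)
open import Level using (_⊔_) renaming (suc to lsuc)
open import Relation.Binary.Bundles using (Setoid)
import Relation.Binary.Construct.On as On
open import Relation.Binary.Core using (Rel)
open import Relation.Binary.Definitions using (WeaklyDecidable)
open import Relation.Binary.PropositionalEquality.Core as ≡ using (_≡_; _≢_)
open import Relation.Binary.Structures using (IsStrictPartialOrder)
open import Relation.Nullary.Decidable.Core using (yes; no; recompute)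
open import Relation.Nullary.Negation.Core using (¬_)

record ArchimedeanField c ℓ₁ ℓ₂ : Set (lsuc (c ⊔ ℓ₁ ⊔ ℓ₂)) where
  infix 4 _<_ _≤_
  field
    heytingField : HeytingField c ℓ₁ ℓ₂

  open HeytingField heytingField public

  commutativeRing : CommutativeRing c ℓ₁
  commutativeRing = record { isCommutativeRing = isCommutativeRing }

  open CommutativeRing commutativeRing public using (ring; semiring)
  open Algebra.Properties.Semiring.Mult.TCOptimised semiring public
    renaming (_×_ to _·_) using (×1-homo-*; ×-homo-+; 1+×)

  fromℕ : ℕ → Carrier
  fromℕ n = n · 1#

  field
    _<_                  : Rel Carrier ℓ₂
    isStrictPartialOrder : IsStrictPartialOrder _≈_ _<_
    #⇒<⊎>                : ∀ {x y} → x # y → x < y ⊎ y < x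
    <⇒#                  : ∀ {x y} → x < y → x # y
    +-monoˡ-<            : ∀ {x y} z → x < y → x + z < y + z
    *-pos                : ∀ {x y} → 0# < x → 0# < y → 0# < x * y
    archimedean          : ∀ x → ∃ λ n → x < fromℕ n

  _≤_ : Rel Carrier ℓ₂
  x ≤ y = ¬ (y < x)

module Sequences {c ℓ₁ ℓ₂} (F : ArchimedeanField c ℓ₁ ℓ₂) where

  open ArchimedeanField F

  infix 4 ∣_∣<_ _⟶_

  record ∣_∣<_ (x ε : Carrier) : Set ℓ₂ where
    constructor _,_
    field
      lower : - ε < x
      upper : x < ε

  IsCauchy : (ℕ → Carrier) → Set (c ⊔ ℓ₂)
  IsCauchy s = ∀ ε → 0# < ε → ∃ λ N → ∀ m n → N ℕ.≤ m → N ℕ.≤ n → ∣ s m - s n ∣< ε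

  _⟶_ : (ℕ → Carrier) → Carrier → Set (c ⊔ ℓ₂)
  s ⟶ x = ∀ ε → 0# < ε → ∃ λ N → ∀ n → N ℕ.≤ n → ∣ s n - x ∣< ε

-- The real numbers, axiomatised as a Cauchy complete Archimedean ordered field.
-- Classically this determines ℝ up to isomorphism; the axioms are stated so
-- that they also hold for the constructive (Cauchy or Dedekind) reals.
record RealField c ℓ₁ ℓ₂ : Set (lsuc (c ⊔ ℓ₁ ⊔ ℓ₂)) where
  field
    archimedeanField : ArchimedeanField c ℓ₁ ℓ₂

  open ArchimedeanField archimedeanField public
  open Sequences archimedeanField public

  field
    complete : ∀ s → IsCauchy s → ∃ (s ⟶_)

module RealAnalysis {c ℓ₁ ℓ₂} (R : RealField c ℓ₁ ℓ₂) where

  open RealField R public renaming (Carrier to ℝ)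
  open IsStrictPartialOrder isStrictPartialOrder public
    using () renaming (irrefl to <-irrefl; trans to <-trans; <-respʳ-≈ to <-respʳ; <-respˡ-≈ to <-respˡ)
  open Algebra.Properties.Ring ring public using (-0#≈0#; -‿involutive; -‿distribˡ-*; -‿distribʳ-*; -‿+-comm)
  open Algebra.Properties.Semiring.Exp semiring public using (_^_)

  fromℤ : ℤ → ℝ
  fromℤ (+ n)    = fromℕ n
  fromℤ -[1+ n ] = - fromℕ (suc n)

  open import Relation.Binary.Reasoning.Setoid setoid

  opaque
    fromℤ-neg : ∀ i → fromℤ (ℤ.- i) ≈ - fromℤ i
    fromℤ-neg (+ zero)    = sym -0#≈0#
    fromℤ-neg (+ suc n)   = refl
    fromℤ-neg -[1+ n ]    = sym (-‿involutive _)

    fromℤ-⊖ : ∀ m n → fromℤ (m ℤ.⊖ n) ≈ fromℕ m - fromℕ n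
    fromℤ-⊖ m       zero    = sym (trans (+-congˡ -0#≈0#) (+-identityʳ _))
    fromℤ-⊖ zero    (suc n) = sym (+-identityˡ _)
    fromℤ-⊖ (suc m) (suc n) = begin
      fromℤ (suc m ℤ.⊖ suc n)                    ≡⟨ ≡.cong fromℤ (ℤ.[1+m]⊖[1+n]≡m⊖n m n) ⟩
      fromℤ (m ℤ.⊖ n)                            ≈⟨ fromℤ-⊖ m n ⟩
      fromℕ m - fromℕ n                          ≈⟨ +-congʳ (+-identityʳ _) ⟨
      (fromℕ m + 0#) - fromℕ n                   ≈⟨ +-congʳ (+-congˡ (-‿inverseʳ 1#)) ⟨
      (fromℕ m + (1# - 1#)) - fromℕ n            ≈⟨ +-congʳ (+-assoc _ _ _) ⟨
      ((fromℕ m + 1#) - 1#) - fromℕ n            ≈⟨ +-assoc _ _ _ ⟩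
      (fromℕ m + 1#) + (- 1# - fromℕ n)          ≈⟨ +-cong (+-comm _ _) (-‿+-comm _ _) ⟩
      (1# + fromℕ m) - (1# + fromℕ n)            ≈⟨ +-cong (1+× m 1#) (-‿cong (1+× n 1#)) ⟨
      fromℕ (suc m) - fromℕ (suc n)              ∎

    fromℤ-+ : ∀ i j → fromℤ (i ℤ.+ j) ≈ fromℤ i + fromℤ j
    fromℤ-+ (+ m)    (+ n)    = ×-homo-+ 1# m n
    fromℤ-+ (+ m)    -[1+ n ] = fromℤ-⊖ m (suc n)
    fromℤ-+ -[1+ m ] (+ n)    = trans (fromℤ-⊖ n (suc m)) (+-comm _ _)
    fromℤ-+ -[1+ m ] -[1+ n ] = begin
      - fromℕ (suc (suc (m ℕ.+ n)))     ≡⟨ ≡.cong (λ k → - fromℕ (suc k)) (ℕ.+-suc m n) ⟨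
      - fromℕ (suc m ℕ.+ suc n)         ≈⟨ -‿cong (×-homo-+ 1# (suc m) (suc n)) ⟩
      - (fromℕ (suc m) + fromℕ (suc n)) ≈⟨ -‿+-comm _ _ ⟨
      - fromℕ (suc m) - fromℕ (suc n)   ∎

    fromℤ-◃⁺ : ∀ n → fromℤ (Sign.+ ℤ.◃ n) ≈ fromℕ n
    fromℤ-◃⁺ n = reflexive (≡.cong fromℤ (ℤ.+◃n≡+n n))

    fromℤ-◃⁻ : ∀ n → fromℤ (Sign.- ℤ.◃ n) ≈ - fromℕ n
    fromℤ-◃⁻ n = trans (reflexive (≡.cong fromℤ (ℤ.-◃n≡-n n))) (fromℤ-neg (+ n))

    fromℤ-* : ∀ i j → fromℤ (i ℤ.* j) ≈ fromℤ i * fromℤ j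
    fromℤ-* (+ m)    (+ n)    = trans (fromℤ-◃⁺ (m ℕ.* n)) (×1-homo-* m n)
    fromℤ-* (+ m)    -[1+ n ] = trans (fromℤ-◃⁻ (m ℕ.* suc n))
      (trans (-‿cong (×1-homo-* m (suc n))) (-‿distribʳ-* _ _))
    fromℤ-* -[1+ m ] (+ n)    = trans (fromℤ-◃⁻ (suc m ℕ.* n))
      (trans (-‿cong (×1-homo-* (suc m) n)) (-‿distribˡ-* _ _))
    fromℤ-* -[1+ m ] -[1+ n ] = begin
      fromℤ (Sign.+ ℤ.◃ (suc m ℕ.* suc n)) ≈⟨ fromℤ-◃⁺ (suc m ℕ.* suc n) ⟩
      fromℕ (suc m ℕ.* suc n)              ≈⟨ ×1-homo-* (suc m) (suc n) ⟩
      fromℕ (suc m) * fromℕ (suc n)        ≈⟨ -‿involutive _ ⟨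
      - - (fromℕ (suc m) * fromℕ (suc n))  ≈⟨ -‿cong (-‿distribˡ-* _ _) ⟩
      - (- fromℕ (suc m) * fromℕ (suc n))  ≈⟨ -‿distribʳ-* _ _ ⟩
      - fromℕ (suc m) * - fromℕ (suc n)    ∎

  private
    fromℤ-morphism : ℤ.+-*-rawRing -Raw-AlmostCommutative⟶ fromCommutativeRing commutativeRing
    fromℤ-morphism = record
      { ⟦_⟧ = fromℤ ; +-homo = fromℤ-+ ; *-homo = fromℤ-* ; -‿homo = fromℤ-neg
      ; 0-homo = refl ; 1-homo = refl }

    fromℤ-≟ : WeaklyDecidable (Induced-equivalence fromℤ-morphism)
    fromℤ-≟ i j with i ℤ.≟ j
    ... | yes i≡j = just (reflexive (≡.cong fromℤ i≡j))
    ... | no  _   = nothing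

  module Solver = Algebra.Solver.Ring ℤ.+-*-rawRing (fromCommutativeRing commutativeRing) fromℤ-morphism fromℤ-≟
  open Solver using (solve; _:+_; _:*_; _:-_; :-_; _:=_; con)

  opaque
    pos-resp : ∀ {x y} → x ≈ y → 0# < x → 0# < y
    pos-resp = <-respʳ

    <⇒pos : ∀ {x y} → x < y → 0# < y - x
    <⇒pos {x} {y} p = <-respˡ (-‿inverseʳ x) (+-monoˡ-< (- x) p)

    pos⇒< : ∀ {x y} → 0# < y - x → x < y
    pos⇒< {x} {y} p = <-respˡ (+-identityˡ x)
      (<-respʳ (solve 2 (λ x y → (y :- x) :+ x := y) refl x y) (+-monoˡ-< x p))

    neg⇒pos : ∀ {x} → x < 0# → 0# < - x
    neg⇒pos {x} p = pos-resp (+-identityˡ (- x)) (<⇒pos p)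

    +-pos : ∀ {x y} → 0# < x → 0# < y → 0# < x + y
    +-pos {x} {y} p q = <-trans q (<-respˡ (+-identityˡ y) (+-monoˡ-< y p))

    <-cotrans : ∀ {x y} → x < y → ∀ z → x < z ⊎ z < y
    <-cotrans p z with #-cotrans (<⇒# p) z
    ... | inj₁ x#z with #⇒<⊎> x#z
    ...   | inj₁ x<z = inj₁ x<z
    ...   | inj₂ z<x = inj₂ (<-trans z<x p)
    <-cotrans p z | inj₂ z#y with #⇒<⊎> z#y
    ...   | inj₁ z<y = inj₂ z<y
    ...   | inj₂ y<z = inj₁ (<-trans p y<z)

    1#0 : 1# # 0#
    1#0 = invertible⇒# (1# , trans (*-identityˡ _) 1-0 , trans (*-identityʳ _) 1-0)
      where
      1-0 : 1# - 0# ≈ 1#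
      1-0 = trans (+-congˡ -0#≈0#) (+-identityʳ 1#)

    0<1 : 0# < 1#
    0<1 with #⇒<⊎> 1#0
    ... | inj₂ p = p
    ... | inj₁ p = pos-resp (solve 0 (:- con 1ℤ :* :- con 1ℤ := con 1ℤ) refl) (*-pos (neg⇒pos p) (neg⇒pos p))

    fromℕ-suc : ∀ n → fromℕ (suc n) ≈ 1# + fromℕ n
    fromℕ-suc n = 1+× n 1#

    fromℕ-pos : ∀ n → 0# < fromℕ (suc n)
    fromℕ-pos zero    = 0<1
    fromℕ-pos (suc n) = pos-resp (sym (fromℕ-suc (suc n))) (+-pos 0<1 (fromℕ-pos n))

    invert : ∀ {x} → 0# < x → ∃ λ y → y * x ≈ 1#
    invert {x} p with #⇒invertible (#-sym (<⇒# p))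
    ... | y , yx≈1 , _ = y , trans (*-congˡ (solve 1 (λ x → x := x :- con 0ℤ) refl x)) yx≈1

    1/ : ∀ x → 0# < x → ℝ
    1/ x p = proj₁ (invert p)

    1/-inverseˡ : ∀ x p → 1/ x p * x ≈ 1#
    1/-inverseˡ x p = proj₂ (invert p)

    1/-inverseʳ : ∀ x p → x * 1/ x p ≈ 1#
    1/-inverseʳ x p = trans (*-comm _ _) (1/-inverseˡ x p)

    1/-cong : ∀ {x y} p q → x ≈ y → 1/ x p ≈ 1/ y q
    1/-cong {x} {y} p q x≈y = begin
      1/ x p                ≈⟨ *-identityʳ _ ⟨
      1/ x p * 1#           ≈⟨ *-congˡ (1/-inverseʳ y q) ⟨
      1/ x p * (y * 1/ y q) ≈⟨ *-assoc _ _ _ ⟨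
      1/ x p * y * 1/ y q   ≈⟨ *-congʳ (*-congˡ x≈y) ⟨
      1/ x p * x * 1/ y q   ≈⟨ *-congʳ (1/-inverseˡ x p) ⟩
      1# * 1/ y q           ≈⟨ *-identityˡ _ ⟩
      1/ y q                ∎

    1/-pos : ∀ x p → 0# < 1/ x p
    1/-pos x p with #⇒<⊎> (invertible⇒# inv)
      where
      1/x-0 : 1/ x p - 0# ≈ 1/ x p
      1/x-0 = solve 1 (λ y → y :- con 0ℤ := y) refl _
      inv : ∃ λ y → y * (1/ x p - 0#) ≈ 1# × (1/ x p - 0#) * y ≈ 1#
      inv = x , trans (*-congˡ 1/x-0) (1/-inverseʳ x p) , trans (*-congʳ 1/x-0) (1/-inverseˡ x p)
    ... | inj₂ q = q
    ... | inj₁ q = ⊥-elim (<-irrefl refl (pos-resp -1+1 (+-pos -1pos 0<1)))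
      where
      -1pos : 0# < - 1#
      -1pos = pos-resp (trans (sym (-‿distribˡ-* _ _)) (-‿cong (1/-inverseˡ x p))) (*-pos (neg⇒pos q) p)
      -1+1 : - 1# + 1# ≈ 0#
      -1+1 = -‿inverseˡ 1#

    pos-cancelˡ : ∀ {x y} → 0# < x → 0# < x * y → 0# < y
    pos-cancelˡ {x} {y} p q = pos-resp
      (trans (sym (*-assoc _ _ _)) (trans (*-congʳ (1/-inverseˡ x p)) (*-identityˡ y)))
      (*-pos (1/-pos x p) q)

    pos-halve : ∀ {x} → 0# < x + x → 0# < x
    pos-halve {x} p with <-cotrans p x
    ... | inj₁ q = q
    ... | inj₂ q = pos-resp (solve 1 (λ x → (x :+ x) :- x := x) refl x) (<⇒pos q)

    2>0 : 0# < 1# + 1#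
    2>0 = +-pos 0<1 0<1

    ½ : ℝ
    ½ = 1/ (1# + 1#) 2>0

    ½+½ : ½ + ½ ≈ 1#
    ½+½ = trans (solve 1 (λ h → h :+ h := h :* (con 1ℤ :+ con 1ℤ)) refl ½) (1/-inverseˡ _ 2>0)

    ½-pos : 0# < ½
    ½-pos = 1/-pos _ 2>0

  opaque
    ∣∣<-pos : ∀ {x ε} → ∣ x ∣< ε → 0# < ε - x × 0# < ε + x
    ∣∣<-pos {x} {ε} (p , q) = <⇒pos q , pos-resp (solve 2 (λ x e → x :- (:- e) := e :+ x) refl x ε) (<⇒pos p)

    pos-∣∣< : ∀ {x ε} → 0# < ε - x → 0# < ε + x → ∣ x ∣< ε
    pos-∣∣< {x} {ε} p q = pos⇒< (pos-resp (solve 2 (λ x e → e :+ x := x :- (:- e)) refl x ε) q) , pos⇒< p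

    ∣∣<-resp : ∀ {x y ε} → x ≈ y → ∣ x ∣< ε → ∣ y ∣< ε
    ∣∣<-resp x≈y (p , q) = <-respʳ x≈y p , <-respˡ x≈y q

    ∣∣<-+ : ∀ {x y a b} → ∣ x ∣< a → ∣ y ∣< b → ∣ x + y ∣< (a + b)
    ∣∣<-+ {x} {y} {a} {b} p q with ∣∣<-pos p | ∣∣<-pos q
    ... | p₁ , p₂ | q₁ , q₂ = pos-∣∣<
      (pos-resp (solve 4 (λ x y a b → (a :- x) :+ (b :- y) := (a :+ b) :- (x :+ y)) refl x y a b) (+-pos p₁ q₁))
      (pos-resp (solve 4 (λ x y a b → (a :+ x) :+ (b :+ y) := (a :+ b) :+ (x :+ y)) refl x y a b) (+-pos p₂ q₂))

    ∣∣<-neg : ∀ {x a} → ∣ x ∣< a → ∣ - x ∣< a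
    ∣∣<-neg {x} {a} p with ∣∣<-pos p
    ... | p₁ , p₂ = pos-∣∣<
      (pos-resp (solve 2 (λ x a → a :+ x := a :- (:- x)) refl x a) p₂) p₁

    ∣∣<-weaken : ∀ {x a b} → ∣ x ∣< a → a < b → ∣ x ∣< b
    ∣∣<-weaken {x} {a} {b} p a<b with ∣∣<-pos p
    ... | p₁ , p₂ = pos-∣∣<
      (pos-resp (solve 3 (λ x a b → (a :- x) :+ (b :- a) := b :- x) refl x a b) (+-pos p₁ (<⇒pos a<b)))
      (pos-resp (solve 3 (λ x a b → (a :+ x) :+ (b :- a) := b :+ x) refl x a b) (+-pos p₂ (<⇒pos a<b)))

    ∣∣<-* : ∀ {x y a b} → ∣ x ∣< a → ∣ y ∣< b → ∣ x * y ∣< (a * b)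
    ∣∣<-* {x} {y} {a} {b} p q with ∣∣<-pos p | ∣∣<-pos q
    ... | p₁ , p₂ | q₁ , q₂ = pos-∣∣<
      (pos-halve (pos-resp
        (solve 4 (λ x y a b → (a :- x) :* (b :+ y) :+ (a :+ x) :* (b :- y)
          := (a :* b :- x :* y) :+ (a :* b :- x :* y)) refl x y a b)
        (+-pos (*-pos p₁ q₂) (*-pos p₂ q₁))))
      (pos-halve (pos-resp
        (solve 4 (λ x y a b → (a :- x) :* (b :- y) :+ (a :+ x) :* (b :+ y)
          := (a :* b :+ x :* y) :+ (a :* b :+ x :* y)) refl x y a b)
        (+-pos (*-pos p₁ q₁) (*-pos p₂ q₂))))

    bound : ∀ x → ∃ λ b → ∣ x ∣< b
    bound x with archimedean x | archimedean (- x)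
    ... | m , p | n , q = fromℕ m + fromℕ n + 1# , pos-∣∣<
        (pos-resp (solve 3 (λ a b x → (a :- x) :+ (b :+ con 1ℤ) := (a :+ b :+ con 1ℤ) :- x) refl (fromℕ m) (fromℕ n) x)
          (+-pos (<⇒pos p) (pos+1 n)))
        (pos-resp (solve 3 (λ a b x → (b :- :- x) :+ (a :+ con 1ℤ) := (a :+ b :+ con 1ℤ) :+ x) refl (fromℕ m) (fromℕ n) x)
          (+-pos (<⇒pos q) (pos+1 m)))
      where
      pos+1 : ∀ n → 0# < fromℕ n + 1#
      pos+1 n = pos-resp (trans (fromℕ-suc n) (+-comm _ _)) (fromℕ-pos n)

    bound-pos : ∀ {x b} → ∣ x ∣< b → 0# < b
    bound-pos {x} {b} p with ∣∣<-pos p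
    ... | p₁ , p₂ = pos-halve (pos-resp (solve 2 (λ x b → (b :- x) :+ (b :+ x) := b :+ b) refl x b) (+-pos p₁ p₂))

  lim : ∀ s → IsCauchy s → ℝ
  lim s cauchy = proj₁ (complete s cauchy)

  opaque
    ⟶-cong : ∀ s t x → (∀ n → s n ≈ t n) → s ⟶ x → t ⟶ x
    ⟶-cong s t x s≈t s⟶x ε ε>0 = proj₁ (s⟶x ε ε>0) , λ n N≤n → ∣∣<-resp (+-congʳ (s≈t n)) (proj₂ (s⟶x ε ε>0) n N≤n)

    ½-double : ∀ z → z ≈ ½ * z + ½ * z
    ½-double z = trans (sym (*-identityˡ z)) (trans (*-congʳ (sym ½+½)) (distribʳ z ½ ½))

    ⟶-unique-≮ : ∀ s x y → s ⟶ x → s ⟶ y → ¬ (x < y)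
    ⟶-unique-≮ s x y s⟶x s⟶y x<y = <-irrefl (½-double (y - x)) (∣_∣<_.upper near)
      where
      d : ℝ
      d = ½ * (y - x)
      d>0 : 0# < d
      d>0 = *-pos ½-pos (<⇒pos x<y)
      M N : ℕ
      M = proj₁ (s⟶x d d>0)
      N = proj₁ (s⟶y d d>0)
      u : ℝ
      u = s (M ℕ.+ N)
      near : ∣ y - x ∣< (d + d)
      near = ∣∣<-resp (solve 3 (λ u x y → (u :- x) :+ (:- (u :- y)) := y :- x) refl u x y)
        (∣∣<-+ (proj₂ (s⟶x d d>0) _ (ℕ.m≤m+n M N)) (∣∣<-neg (proj₂ (s⟶y d d>0) _ (ℕ.m≤n+m N M))))

    ⟶-unique : ∀ s x y → s ⟶ x → s ⟶ y → x ≈ y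
    ⟶-unique s x y s⟶x s⟶y = proj₁ (tight x y) (λ x#y → apart (#⇒<⊎> x#y))
      where
      apart : x < y ⊎ y < x → ⊥
      apart (inj₁ x<y) = ⟶-unique-≮ s x y s⟶x s⟶y x<y
      apart (inj₂ y<x) = ⟶-unique-≮ s y x s⟶y s⟶x y<x

    lim-cong : ∀ s t p q → (∀ n → s n ≈ t n) → lim s p ≈ lim t q
    lim-cong s t p q s≈t =
      ⟶-unique t (lim s p) (lim t q) (⟶-cong s t (lim s p) s≈t (proj₂ (complete s p))) (proj₂ (complete t q))

  opaque
    ½^-pos : ∀ n → 0# < ½ ^ n
    ½^-pos zero    = 0<1
    ½^-pos (suc n) = *-pos ½-pos (½^-pos n)

    ½^-double : ∀ n → ½ ^ n ≈ ½ ^ suc n + ½ ^ suc n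
    ½^-double n = ½-double (½ ^ n)

    ½^<2 : ∀ n → ½ ^ n < 1# + 1#
    ½^<2 zero    = pos⇒< (pos-resp (solve 0 (con 1ℤ := con 1ℤ :+ con 1ℤ :- con 1ℤ) refl) 0<1)
    ½^<2 (suc n) = <-trans (pos⇒< (pos-resp
      (trans (solve 1 (λ q → q := (q :+ q) :- q) refl (½ ^ suc n)) (+-congʳ (sym (½^-double n))))
      (½^-pos (suc n)))) (½^<2 n)

    n½^n<2 : ∀ n → fromℕ n * ½ ^ n < 1# + 1#
    n½^n<2 zero    = <-respˡ (sym (zeroˡ _)) 2>0
    n½^n<2 (suc n) = pos⇒< (pos-halve (pos-resp
      (trans
        (+-cong (+-congˡ (-‿cong (*-congˡ (½^-double n)))) (+-congˡ (-‿cong (½^-double n))))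
        (trans
          (solve 2 (λ n q → (con (+ 2) :- n :* (q :+ q)) :+ (con (+ 2) :- (q :+ q))
            := (con (+ 2) :- (con 1ℤ :+ n) :* q) :+ (con (+ 2) :- (con 1ℤ :+ n) :* q)) refl (fromℕ n) (½ ^ suc n))
          (+-cong (+-congˡ (-‿cong (*-congʳ (sym (fromℕ-suc n))))) (+-congˡ (-‿cong (*-congʳ (sym (fromℕ-suc n))))))))
      (+-pos (<⇒pos (n½^n<2 n)) (<⇒pos (½^<2 n)))))

    ½^-null : ∀ D ε → 0# < D → 0# < ε → ∃ λ n → D * ½ ^ n < ε
    ½^-null D ε D>0 ε>0 with archimedean ((D + D) * 1/ ε ε>0)
    ... | n , p = n , pos⇒< (pos-cancelˡ n>0 (pos-resp
        (trans
          (+-congʳ (*-congˡ (+-congˡ (-‿cong (trans (*-assoc _ _ _) (*-congˡ (1/-inverseˡ ε ε>0)))))))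
          (solve 4 (λ D e n q → con 1ℤ :* (n :* e :- (D :+ D) :* con 1ℤ) :+ D :* (con (+ 2) :- n :* q)
            := n :* (e :- D :* q)) refl D ε (fromℕ n) (½ ^ n)))
        (+-pos (*-pos 0<1 nε>) (*-pos D>0 (<⇒pos (n½^n<2 n))))))
      where
      r : ℝ
      r = (D + D) * 1/ ε ε>0
      n>0 : 0# < fromℕ n
      n>0 = <-trans (*-pos (+-pos D>0 D>0) (1/-pos ε ε>0)) p
      nε> : 0# < fromℕ n * ε - r * ε
      nε> = pos-resp (solve 3 (λ n r e → e :* (n :- r) := n :* e :- r :* e) refl (fromℕ n) r ε) (*-pos ε>0 (<⇒pos p))

  module _ (s : ℕ → ℝ) (C : ℝ) (N : ℕ) (C>0 : 0# < C)
           (step : ∀ n → ∣ s (suc (n ℕ.+ N)) - s (n ℕ.+ N) ∣< (C * ½ ^ n)) where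

    private
      2C 4C : ℝ
      2C = C + C
      4C = 2C + 2C

    opaque
      2C>0 : 0# < 2C
      2C>0 = +-pos C>0 C>0

      4C>0 : 0# < 4C
      4C>0 = +-pos 2C>0 2C>0

      partial : ∀ n j → ∣ s (j ℕ.+ (n ℕ.+ N)) - s (n ℕ.+ N) ∣< (4C * ½ ^ n - 2C * ½ ^ (j ℕ.+ n))
      partial n zero = pos-∣∣<
        (pos-resp (solve 3 (λ x D p → D :* p := ((D :+ D) :* p :- D :* p) :- (x :- x)) refl (s (n ℕ.+ N)) 2C (½ ^ n)) pos)
        (pos-resp (solve 3 (λ x D p → D :* p := ((D :+ D) :* p :- D :* p) :+ (x :- x)) refl (s (n ℕ.+ N)) 2C (½ ^ n)) pos)
        where
        pos : 0# < 2C * ½ ^ n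
        pos = *-pos 2C>0 (½^-pos n)
      partial n (suc j) = widen (∣∣<-resp
        (solve 3 (λ u v w → (u :- v) :+ (v :- w) := u :- w) refl (s (suc j ℕ.+ M)) (s (j ℕ.+ M)) (s M))
        (∣∣<-+ step′ (partial n j)))
        where
        M : ℕ
        M = n ℕ.+ N
        step′ : ∣ s (suc (j ℕ.+ M)) - s (j ℕ.+ M) ∣< (C * ½ ^ (j ℕ.+ n))
        step′ = ≡.subst (λ i → ∣ s (suc i) - s i ∣< (C * ½ ^ (j ℕ.+ n))) (ℕ.+-assoc j n N) (step (j ℕ.+ n))
        q : ℝ
        q = ½ ^ (suc j ℕ.+ n)
        eq : C * ½ ^ (j ℕ.+ n) + (4C * ½ ^ n - 2C * ½ ^ (j ℕ.+ n)) ≈ 4C * ½ ^ n - 2C * q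
        eq = trans (+-cong (*-congˡ (½^-double (j ℕ.+ n))) (+-congˡ (-‿cong (*-congˡ (½^-double (j ℕ.+ n))))))
          (solve 3 (λ C q a → C :* (q :+ q) :+ (a :- (C :+ C) :* (q :+ q)) := a :- (C :+ C) :* q) refl C q (4C * ½ ^ n))
        widen : ∀ {x} → ∣ x ∣< (C * ½ ^ (j ℕ.+ n) + (4C * ½ ^ n - 2C * ½ ^ (j ℕ.+ n))) → ∣ x ∣< (4C * ½ ^ n - 2C * q)
        widen (p , r) = <-respˡ (-‿cong eq) p , <-respʳ eq r

      near : ∀ n m → n ℕ.+ N ℕ.≤ m → ∣ s m - s (n ℕ.+ N) ∣< (4C * ½ ^ n)
      near n m M≤m = ≡.subst (λ i → ∣ s i - s (n ℕ.+ N) ∣< (4C * ½ ^ n)) (ℕ.m∸n+n≡m M≤m)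
        (∣∣<-weaken (partial n j) (pos⇒<
          (pos-resp (solve 2 (λ a b → b := a :- (a :- b)) refl (4C * ½ ^ n) (2C * ½ ^ (j ℕ.+ n)))
            (*-pos 2C>0 (½^-pos (j ℕ.+ n))))))
        where
        j : ℕ
        j = m ℕ.∸ (n ℕ.+ N)

      close : ∀ ε n → (4C + 4C) * ½ ^ n < ε → ∀ m m′ → n ℕ.+ N ℕ.≤ m → n ℕ.+ N ℕ.≤ m′ → ∣ s m - s m′ ∣< ε
      close ε n small m m′ p q = ∣∣<-weaken
        (∣∣<-resp (solve 3 (λ u v w → (u :- w) :+ (:- (v :- w)) := u :- v) refl (s m) (s m′) (s (n ℕ.+ N)))
          (∣∣<-+ (near n m p) (∣∣<-neg (near n m′ q))))
        (<-respˡ (solve 2 (λ A p → (A :+ A) :* p := A :* p :+ A :* p) refl 4C (½ ^ n)) small)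

      geometric-cauchy : IsCauchy s
      geometric-cauchy ε ε>0 = proj₁ small ℕ.+ N , close ε (proj₁ small) (proj₂ small)
        where
        small : ∃ λ n → (4C + 4C) * ½ ^ n < ε
        small = ½^-null (4C + 4C) ε (+-pos 4C>0 4C>0) ε>0

  -- ∑ t n is t 0 + ⋯ + t (n - 1).
  ∑ : (ℕ → ℝ) → ℕ → ℝ
  ∑ t zero    = 0#
  ∑ t (suc n) = ∑ t n + t n

  opaque
    series-cauchy : ∀ t C N → 0# < C → (∀ n → ∣ t (n ℕ.+ N) ∣< (C * ½ ^ n)) → IsCauchy (∑ t)
    series-cauchy t C N C>0 small = geometric-cauchy (∑ t) C N C>0 λ n →
      ∣∣<-resp (solve 2 (λ x y → y := (x :+ y) :- x) refl (∑ t (n ℕ.+ N)) (t (n ℕ.+ N))) (small n)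

    ∑-cong : ∀ s t → (∀ n → s n ≈ t n) → ∀ n → ∑ s n ≈ ∑ t n
    ∑-cong s t s≈t zero    = refl
    ∑-cong s t s≈t (suc n) = +-cong (∑-cong s t s≈t n) (s≈t n)

  -- Euler's series π = ∑ₙ 2ⁿ⁺¹ (n!)² / (2n+1)!, whose consecutive terms have
  -- ratio (n + 1) / (2n + 3).
  πTerm : ℕ → ℝ
  πTerm zero    = fromℕ 2
  πTerm (suc n) = πTerm n * (fromℕ (suc n) * 1/ (fromℕ (suc (2 ℕ.* suc n))) (fromℕ-pos (2 ℕ.* suc n)))

  opaque
    πTerm-pos : ∀ n → 0# < πTerm n
    πTerm-pos zero    = fromℕ-pos 1
    πTerm-pos (suc n) = *-pos (πTerm-pos n) (*-pos (fromℕ-pos n) (1/-pos _ _))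

    πTerm-bound : ∀ n → πTerm n < fromℕ 3 * ½ ^ n
    πTerm-bound zero    = pos⇒< (pos-resp (solve 0 (con 1ℤ := con (+ 3) :* con 1ℤ :- con (+ 2)) refl) 0<1)
    πTerm-bound (suc n) = pos⇒< (pos-resp eq
      (*-pos (1/-pos d d>0) (+-pos (*-pos (fromℕ-pos n) below) (*-pos (fromℕ-pos 2) (½^-pos (suc n))))))
      where
      a d q r t : ℝ
      a = fromℕ (suc n)
      d = fromℕ (suc (2 ℕ.* suc n))
      q = ½ ^ suc n
      t = πTerm n
      d>0 : 0# < d
      d>0 = fromℕ-pos (2 ℕ.* suc n)
      r = 1/ d d>0
      below : 0# < fromℕ 3 * (q + q) - t
      below = pos-resp (+-congʳ (*-congˡ (½^-double n))) (<⇒pos (πTerm-bound n))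
      d≈ : d ≈ 1# + fromℕ 2 * a
      d≈ = trans (fromℕ-suc (2 ℕ.* suc n)) (+-congˡ (×1-homo-* 2 (suc n)))
      eq : r * (a * (fromℕ 3 * (q + q) - t) + fromℕ 3 * q) ≈ fromℕ 3 * q - t * (a * r)
      eq = begin
        r * (a * (fromℕ 3 * (q + q) - t) + fromℕ 3 * q)
          ≈⟨ solve 4 (λ r a q t → r :* (a :* (con (+ 3) :* (q :+ q) :- t) :+ con (+ 3) :* q)
               := (r :* (con 1ℤ :+ con (+ 2) :* a)) :* (con (+ 3) :* q) :- t :* (a :* r)) refl r a q t ⟩
        (r * (1# + fromℕ 2 * a)) * (fromℕ 3 * q) - t * (a * r)
          ≈⟨ +-congʳ (*-congʳ (trans (*-congˡ (sym d≈)) (1/-inverseˡ d d>0))) ⟩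
        1# * (fromℕ 3 * q) - t * (a * r)
          ≈⟨ +-congʳ (*-identityˡ _) ⟩
        fromℕ 3 * q - t * (a * r) ∎

    π-cauchy : IsCauchy (∑ πTerm)
    π-cauchy = series-cauchy πTerm (fromℕ 3) 0 (fromℕ-pos 2) λ n →
      ≡.subst (λ k → ∣ πTerm k ∣< (fromℕ 3 * ½ ^ n)) (≡.sym (ℕ.+-identityʳ n))
        (pos-∣∣< (<⇒pos (πTerm-bound n)) (+-pos (*-pos (fromℕ-pos 2) (½^-pos n)) (πTerm-pos n)))

  π : ℝ
  π = lim (∑ πTerm) π-cauchy

  infix 5 _+i_
  record ℂ : Set c where
    constructor _+i_
    field
      re im : ℝ
  open ℂ public

  infix 4 _≈ᶜ_
  record _≈ᶜ_ (z w : ℂ) : Set ℓ₁ where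
    constructor _,_
    field
      re≈ : re z ≈ re w
      im≈ : im z ≈ im w
  open _≈ᶜ_ public

  ℂ-setoid : Setoid c ℓ₁
  ℂ-setoid = record
    { Carrier = ℂ
    ; _≈_ = _≈ᶜ_
    ; isEquivalence = record
      { refl  = refl , refl
      ; sym   = λ { (p , q) → sym p , sym q }
      ; trans = λ { (p , q) (p′ , q′) → trans p p′ , trans q q′ }
      }
    }

  open Setoid ℂ-setoid public using () renaming (refl to reflᶜ; sym to symᶜ; trans to transᶜ)

  infixl 6 _+ᶜ_ _-ᶜ_
  infixl 7 _*ᶜ_
  infix  8 -ᶜ_

  real : ℝ → ℂ
  real x = x +i 0#

  int : ℤ → ℂ
  int n = real (fromℤ n)

  0ᶜ 1ᶜ i : ℂ
  0ᶜ = 0# +i 0#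
  1ᶜ = 1# +i 0#
  i  = 0# +i 1#

  _+ᶜ_ _-ᶜ_ _*ᶜ_ : ℂ → ℂ → ℂ
  z +ᶜ w = re z + re w +i im z + im w
  z -ᶜ w = re z - re w +i im z - im w
  z *ᶜ w = re z * re w - im z * im w +i re z * im w + im z * re w

  -ᶜ_ : ℂ → ℂ
  -ᶜ z = - re z +i - im z

  ∥_∥² : ℂ → ℝ
  ∥ z ∥² = re z * re z + im z * im z

  -- ∣ z ∣ < B, without the square root.
  infix 4 ∣_∣ᶜ<_
  ∣_∣ᶜ<_ : ℂ → ℝ → Set ℓ₂
  ∣ z ∣ᶜ< B = 0# < B × ∥ z ∥² < B * B

  Nonzero : ℂ → Set ℓ₂
  Nonzero z = 0# < ∥ z ∥²

  infixl 7 _/ᶜ_⟨_⟩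
  _/ᶜ_⟨_⟩ : ℂ → ∀ w → Nonzero w → ℂ
  z /ᶜ w ⟨ w≢0 ⟩ = z *ᶜ (re w * 1/ ∥ w ∥² w≢0 +i - im w * 1/ ∥ w ∥² w≢0)

  opaque
    real-cong : ∀ {x y} → x ≈ y → real x ≈ᶜ real y
    real-cong p = p , refl

    +ᶜ-cong : ∀ {z z′ w w′} → z ≈ᶜ z′ → w ≈ᶜ w′ → z +ᶜ w ≈ᶜ z′ +ᶜ w′
    +ᶜ-cong (p , q) (p′ , q′) = +-cong p p′ , +-cong q q′

    *ᶜ-cong : ∀ {z z′ w w′} → z ≈ᶜ z′ → w ≈ᶜ w′ → z *ᶜ w ≈ᶜ z′ *ᶜ w′
    *ᶜ-cong (p , q) (p′ , q′) =
      +-cong (*-cong p p′) (-‿cong (*-cong q q′)) , +-cong (*-cong p q′) (*-cong q p′)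

    -ᶜ-cong : ∀ {z w} → z ≈ᶜ w → -ᶜ z ≈ᶜ -ᶜ w
    -ᶜ-cong (p , q) = -‿cong p , -‿cong q

    ∥∥²-cong : ∀ {z w} → z ≈ᶜ w → ∥ z ∥² ≈ ∥ w ∥²
    ∥∥²-cong (p , q) = +-cong (*-cong p p) (*-cong q q)

    /ᶜ-cong : ∀ {z z′ w w′} r r′ → z ≈ᶜ z′ → w ≈ᶜ w′ → z /ᶜ w ⟨ r ⟩ ≈ᶜ z′ /ᶜ w′ ⟨ r′ ⟩
    /ᶜ-cong {w = w} {w′ = w′} r r′ z≈ w≈@(p , q) = *ᶜ-cong z≈ (*-cong p 1/≈ , *-cong (-‿cong q) 1/≈)
      where
      1/≈ : 1/ ∥ w ∥² r ≈ 1/ ∥ w′ ∥² r′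
      1/≈ = 1/-cong r r′ (∥∥²-cong w≈)

  expTerm : ℂ → ℕ → ℂ
  expTerm z zero    = 1ᶜ
  expTerm z (suc n) = expTerm z n *ᶜ z *ᶜ real (1/ (fromℕ (suc n)) (fromℕ-pos n))

  opaque
    expTerm-cong : ∀ {z w} → z ≈ᶜ w → ∀ n → expTerm z n ≈ᶜ expTerm w n
    expTerm-cong z≈w zero    = reflᶜ
    expTerm-cong z≈w (suc n) = *ᶜ-cong (*ᶜ-cong (expTerm-cong z≈w n) z≈w) reflᶜ

    private
      shrink : ∀ X B q d (d>0 : 0# < d) → 0# < q → 0# < d - B → ∣ X ∣< (B * q) → ∣ X * 1/ d d>0 ∣< q
      shrink X B q d d>0 q>0 B<d small with ∣∣<-pos small
      ... | p₁ , p₂ = pos-∣∣<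
          (pos-resp
            (trans (solve 5 (λ X B q d r → r :* ((d :- B) :* q :+ (B :* q :- X)) := (r :* d) :* q :- X :* r) refl X B q d r)
              (+-congʳ one))
            (*-pos r>0 (+-pos (*-pos B<d q>0) p₁)))
          (pos-resp
            (trans (solve 5 (λ X B q d r → r :* ((d :- B) :* q :+ (B :* q :+ X)) := (r :* d) :* q :+ X :* r) refl X B q d r)
              (+-congʳ one))
            (*-pos r>0 (+-pos (*-pos B<d q>0) p₂)))
        where
        r : ℝ
        r = 1/ d d>0
        r>0 : 0# < r
        r>0 = 1/-pos d d>0
        one : (r * d) * q ≈ q
        one = trans (*-congʳ (1/-inverseˡ d d>0)) (*-identityˡ q)

      square : ℂ → ℝ → Set ℓ₂
      square z b = ∣ re z ∣< b × ∣ im z ∣< b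

      square-* : ∀ z w b b′ → square z b → square w b′ → square (z *ᶜ w) (b * b′ + b * b′)
      square-* z w b b′ (p , q) (p′ , q′) =
        ∣∣<-+ (∣∣<-* p p′) (∣∣<-neg (∣∣<-* q q′)) , ∣∣<-+ (∣∣<-* p q′) (∣∣<-* q p′)

      square-bound : ∀ z → ∃ (square z)
      square-bound z with bound (re z) | bound (im z)
      ... | b , p | b′ , p′ = b + b′ ,
        ∣∣<-weaken p (pos⇒< (pos-resp (solve 2 (λ b b′ → b′ := (b :+ b′) :- b) refl b b′) (bound-pos p′))) ,
        ∣∣<-weaken p′ (pos⇒< (pos-resp (solve 2 (λ b b′ → b := (b :+ b′) :- b′) refl b b′) (bound-pos p)))

    expTerm-bound : ∀ z → ∃ λ C → ∃ λ N → 0# < C × (∀ n →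
      ∣ re (expTerm z (n ℕ.+ N)) ∣< (C * ½ ^ n) × ∣ im (expTerm z (n ℕ.+ N)) ∣< (C * ½ ^ n))
    expTerm-bound z = C , N , C>0 , terms
      where
      M : ℝ
      M = proj₁ (square-bound z)
      4M : ℝ
      4M = (M + M) + (M + M)
      N : ℕ
      N = proj₁ (archimedean 4M)
      first : ∃ (square (expTerm z N))
      first = square-bound (expTerm z N)
      C : ℝ
      C = proj₁ first
      C>0 : 0# < C
      C>0 = bound-pos (proj₁ (proj₂ first))
      large : ∀ n → 0# < fromℕ (suc (n ℕ.+ N)) - 4M
      large n = pos-resp
        (trans (solve 3 (λ a N M → a :+ (N :- M) := (a :+ N) :- M) refl (fromℕ (suc n)) (fromℕ N) 4M)
          (+-congʳ (sym (×-homo-+ 1# (suc n) N))))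
        (+-pos (fromℕ-pos n) (<⇒pos (proj₂ (archimedean 4M))))
      terms : ∀ n → square (expTerm z (n ℕ.+ N)) (C * ½ ^ n)
      terms zero    = ∣∣<-≈ (sym (*-identityʳ C)) (proj₁ (proj₂ first)) , ∣∣<-≈ (sym (*-identityʳ C)) (proj₂ (proj₂ first))
        where
        ∣∣<-≈ : ∀ {x a b} → a ≈ b → ∣ x ∣< a → ∣ x ∣< b
        ∣∣<-≈ a≈b (p , q) = <-respˡ (-‿cong a≈b) p , <-respʳ a≈b q
      terms (suc n) =
        ∣∣<-resp (solve 3 (λ x y r → x :* r := x :* r :- y :* con 0ℤ) refl X Y r) (scaled (proj₁ big)) ,
        ∣∣<-resp (solve 3 (λ x y r → y :* r := x :* con 0ℤ :+ y :* r) refl X Y r) (scaled (proj₂ big))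
        where
        q r X Y : ℝ
        q = C * ½ ^ suc n
        r = 1/ (fromℕ (suc (n ℕ.+ N))) (fromℕ-pos (n ℕ.+ N))
        X = re (expTerm z (n ℕ.+ N) *ᶜ z)
        Y = im (expTerm z (n ℕ.+ N) *ᶜ z)
        big : square (expTerm z (n ℕ.+ N) *ᶜ z) (C * ½ ^ n * M + C * ½ ^ n * M)
        big = square-* (expTerm z (n ℕ.+ N)) z (C * ½ ^ n) M (terms n) (proj₂ (square-bound z))
        radius : C * ½ ^ n * M + C * ½ ^ n * M ≈ 4M * q
        radius = trans (+-cong (*-congʳ (*-congˡ (½^-double n))) (*-congʳ (*-congˡ (½^-double n))))
          (solve 3 (λ C h M → C :* (h :+ h) :* M :+ C :* (h :+ h) :* M := ((M :+ M) :+ (M :+ M)) :* (C :* h))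
            refl C (½ ^ suc n) M)
        scaled : ∀ {x} → ∣ x ∣< (C * ½ ^ n * M + C * ½ ^ n * M) → ∣ x * r ∣< q
        scaled {x} (p , p′) = shrink x 4M q _ _ (*-pos C>0 (½^-pos (suc n))) (large n)
          (<-respˡ (-‿cong radius) p , <-respʳ radius p′)

    exp-cauchy : ∀ z → IsCauchy (∑ (λ n → re (expTerm z n))) × IsCauchy (∑ (λ n → im (expTerm z n)))
    exp-cauchy z with expTerm-bound z
    ... | C , N , C>0 , small =
      series-cauchy (λ n → re (expTerm z n)) C N C>0 (λ n → proj₁ (small n)) ,
      series-cauchy (λ n → im (expTerm z n)) C N C>0 (λ n → proj₂ (small n))

  exp : ℂ → ℂ
  exp z = lim (∑ (λ n → re (expTerm z n))) (proj₁ (exp-cauchy z))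
       +i lim (∑ (λ n → im (expTerm z n))) (proj₂ (exp-cauchy z))

  opaque
    exp-cong : ∀ {z w} → z ≈ᶜ w → exp z ≈ᶜ exp w
    exp-cong {z} {w} z≈w =
      lim-cong _ _ _ _ (∑-cong (λ n → re (expTerm z n)) (λ n → re (expTerm w n)) (λ n → re≈ (expTerm-cong z≈w n))) ,
      lim-cong _ _ _ _ (∑-cong (λ n → im (expTerm z n)) (λ n → im (expTerm w n)) (λ n → im≈ (expTerm-cong z≈w n)))

  expᴿ : ℝ → ℝ
  expᴿ x = re (exp (real x))

  -- ℂ ∖ {0}, with the position relative to the real axis made explicit: a branch
  -- of the logarithm jumps across a cut, so constructively it is a function only
  -- of points for which this position is known. It is known for every cτ + d.
  data LogDomain (w : ℂ) : Set (ℓ₁ ⊔ ℓ₂) where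
    upper : 0# < im w → LogDomain w
    lower : im w < 0# → LogDomain w
    axis  : im w ≈ 0# → re w # 0# → LogDomain w

  -- A branch of the logarithm, with argument in a closed window of length 2π so
  -- that it covers every choice of cut and of the values on the cut; the
  -- principal branch has θ = - π.
  record LogBranch : Set (c ⊔ ℓ₁ ⊔ ℓ₂) where
    field
      log      : ∀ w → LogDomain w → ℂ
      log-cong : ∀ {w w′} d d′ → w ≈ᶜ w′ → log w d ≈ᶜ log w′ d′
      exp-log  : ∀ w d → exp (log w d) ≈ᶜ w
      θ        : ℝ
      arg≥θ    : ∀ w d → θ ≤ im (log w d)
      arg≤θ+2π : ∀ w d → im (log w d) ≤ θ + fromℕ 2 * π

    infix 9 _^ᶜ_⟨_⟩
    _^ᶜ_⟨_⟩ : ∀ w → ℂ → LogDomain w → ℂ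
    w ^ᶜ s ⟨ d ⟩ = exp (s *ᶜ log w d)

    -- For every branch, re (log w) is the real logarithm of ∣ w ∣.
    ∣_∣^_⟨_⟩ : ∀ w → ℝ → LogDomain w → ℝ
    ∣ w ∣^ s ⟨ d ⟩ = expᴿ (s * re (log w d))

    _^ᴿ_⟨_⟩ : ∀ x → ℝ → 0# < x → ℝ
    x ^ᴿ s ⟨ x>0 ⟩ = ∣ real x ∣^ s ⟨ axis refl (#-sym (<⇒# x>0)) ⟩

-- Without eta, products of variables do not unfold into integer polynomials.
record SL₂ℤ : Set where
  no-eta-equality
  pattern
  constructor mat
  field
    a b c d : ℤ
    .det    : a ℤ.* d ℤ.- b ℤ.* c ≡ 1ℤ

opaque
  det-* : ∀ a b c d a′ b′ c′ d′ →
    (a ℤ.* a′ ℤ.+ b ℤ.* c′) ℤ.* (c ℤ.* b′ ℤ.+ d ℤ.* d′) ℤ.- (a ℤ.* b′ ℤ.+ b ℤ.* d′) ℤ.* (c ℤ.* a′ ℤ.+ d ℤ.* c′)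
      ≡ (a ℤ.* d ℤ.- b ℤ.* c) ℤ.* (a′ ℤ.* d′ ℤ.- b′ ℤ.* c′)
  det-* = solve-∀

  det-inv : ∀ a b c d → d ℤ.* a ℤ.- (ℤ.- b) ℤ.* (ℤ.- c) ≡ a ℤ.* d ℤ.- b ℤ.* c
  det-inv = solve-∀

infixl 7 _∙_
_∙_ : SL₂ℤ → SL₂ℤ → SL₂ℤ
mat a b c d p ∙ mat a′ b′ c′ d′ p′ = mat
  (a ℤ.* a′ ℤ.+ b ℤ.* c′) (a ℤ.* b′ ℤ.+ b ℤ.* d′)
  (c ℤ.* a′ ℤ.+ d ℤ.* c′) (c ℤ.* b′ ℤ.+ d ℤ.* d′)
  (≡.trans (det-* a b c d a′ b′ c′ d′) (≡.cong₂ ℤ._*_ p p′))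

I -I S T : SL₂ℤ
I  = mat 1ℤ 0ℤ 0ℤ 1ℤ ≡.refl
-I = mat -1ℤ 0ℤ 0ℤ -1ℤ ≡.refl
S  = mat 1ℤ 1ℤ 0ℤ 1ℤ ≡.refl
T  = mat 0ℤ -1ℤ 1ℤ 0ℤ ≡.refl

_⁻¹ : SL₂ℤ → SL₂ℤ
mat a b c d p ⁻¹ = mat d (ℤ.- b) (ℤ.- c) a (≡.trans (det-inv a b c d) p)

infixr 8 _^ᴹ_
_^ᴹ_ : SL₂ℤ → ℤ → SL₂ℤ
M ^ᴹ (+ zero)        = I
M ^ᴹ (+ suc n)       = M ∙ M ^ᴹ (+ n)
M ^ᴹ -[1+ zero ]     = M ⁻¹
M ^ᴹ -[1+ suc n ]    = M ⁻¹ ∙ M ^ᴹ -[1+ n ]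

record Γᴶ : Set where
  no-eta-equality
  pattern
  constructor [_,_,_]
  field
    M   : SL₂ℤ
    λ′ μ : ℤ

infixl 7 _∙ᴶ_
_∙ᴶ_ : Γᴶ → Γᴶ → Γᴶ
[ M₁ , λ₁ , μ₁ ] ∙ᴶ [ M₂@(mat a b c d _) , λ₂ , μ₂ ] =
  [ M₁ ∙ M₂ , λ₁ ℤ.* a ℤ.+ μ₁ ℤ.* c ℤ.+ λ₂ , λ₁ ℤ.* b ℤ.+ μ₁ ℤ.* d ℤ.+ μ₂ ]

module JacobiForms {c ℓ₁ ℓ₂} (R : RealField c ℓ₁ ℓ₂) (B : RealAnalysis.LogBranch R) where

  open RealAnalysis R
  open LogBranch B
  open Solver using (solve; _:+_; _:*_; _:-_; :-_; _:=_; con)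
  open SL₂ℤ using () renaming (c to ₂₁; d to ₂₂)

  record ℍ : Set (c ⊔ ℓ₂) where
    constructor _,_
    field
      val  : ℂ
      im>0 : 0# < im val
  open ℍ

  Points : Setoid (c ⊔ ℓ₂) ℓ₁
  Points = ×-setoid (On.setoid ℂ-setoid val) ℂ-setoid

  -- cτ + d
  denominator : SL₂ℤ → ℍ → ℂ
  denominator (mat _ _ c d _) τ = int c *ᶜ val τ +ᶜ int d

  opaque
    private
      re-affine : ∀ c d τ → fromℤ c * re (val τ) + fromℤ d ≈ re (int c *ᶜ val τ +ᶜ int d)
      re-affine c d τ = solve 4 (λ c u v d → c :* u :+ d := (c :* u :- con 0ℤ :* v) :+ d) refl _ _ (im (val τ)) _

      im-affine : ∀ c d τ → fromℤ c * im (val τ) ≈ im (int c *ᶜ val τ +ᶜ int d)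
      im-affine c d τ = solve 3 (λ c u v → c :* v := (c :* v :+ con 0ℤ :* u) :+ con 0ℤ) refl _ (re (val τ)) _

      fromℤ-# : ∀ n → n ≢ 0ℤ → fromℤ n # 0#
      fromℤ-# (+ zero)  n≢0 = ⊥-elim (n≢0 ≡.refl)
      fromℤ-# (+ suc n) _   = #-sym (<⇒# (fromℕ-pos n))
      fromℤ-# -[1+ n ]  _   = <⇒# (pos⇒< (pos-resp (solve 1 (λ x → x := con 0ℤ :- (:- x)) refl _) (fromℕ-pos n)))

      d≢0 : ∀ a b d → a ℤ.* d ℤ.- b ℤ.* 0ℤ ≡ 1ℤ → d ≢ 0ℤ
      d≢0 a b d det ≡.refl with ≡.trans (≡.sym det) (zero-det a b)
        where
        zero-det : ∀ a b → a ℤ.* 0ℤ ℤ.- b ℤ.* 0ℤ ≡ 0ℤ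
        zero-det = solve-∀
      ... | ()

    denominator-domain : ∀ M τ → LogDomain (denominator M τ)
    denominator-domain (mat a b (+ suc n) d _) τ =
      upper (pos-resp (im-affine (+ suc n) d τ) (*-pos (fromℕ-pos n) (im>0 τ)))
    denominator-domain (mat a b -[1+ n ] d _) τ =
      lower (pos⇒< (pos-resp
        (trans (solve 2 (λ c v → c :* v := con 0ℤ :- (:- c) :* v) refl _ _) (+-congˡ (-‿cong (im-affine -[1+ n ] d τ))))
        (*-pos (fromℕ-pos n) (im>0 τ))))
    denominator-domain (mat a b (+ zero) d det) τ =
      axis (trans (sym (im-affine 0ℤ d τ)) (zeroˡ _))
        (#-resp d≈ (fromℤ-# d (d≢0 a b d (recompute (_ ℤ.≟ _) det))))
      where
      d≈ : fromℤ d ≈ re (int 0ℤ *ᶜ val τ +ᶜ int d)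
      d≈ = trans (trans (sym (+-identityˡ _)) (+-congʳ (sym (zeroˡ _)))) (re-affine 0ℤ d τ)
      #-resp : ∀ {x y} → x ≈ y → x # 0# → y # 0#
      #-resp {x} {y} x≈y x#0 with #-cotrans x#0 y
      ... | inj₁ x#y = ⊥-elim (#-irrefl x≈y x#y)
      ... | inj₂ y#0 = y#0

    private
      squares-pos : ∀ u v → 0# < v → 0# < u * u + v * v
      squares-pos u v v>0 with <-cotrans v>0 u
      ... | inj₁ u>0 = +-pos (*-pos u>0 u>0) (*-pos v>0 v>0)
      ... | inj₂ u<v with <-cotrans (pos⇒< {x = - v} {y = 0#} (pos-resp (solve 1 (λ v → v := con 0ℤ :- (:- v)) refl v) v>0)) u
      ...   | inj₂ u<0 = pos-resp (solve 2 (λ u v → (:- u) :* (:- u) :+ v :* v := u :* u :+ v :* v) refl u v)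
                (+-pos (*-pos (neg⇒pos u<0) (neg⇒pos u<0)) (*-pos v>0 v>0))
      ...   | inj₁ -v<u = pos-halve (pos-resp
                (solve 2 (λ u v → (v :- u) :* (v :- u) :+ (u :- (:- v)) :* (u :- (:- v))
                  := (u :* u :+ v :* v) :+ (u :* u :+ v :* v)) refl u v)
                (+-pos (*-pos (<⇒pos u<v) (<⇒pos u<v)) (*-pos (<⇒pos -v<u) (<⇒pos -v<u))))

    domain⇒nonzero : ∀ {w} → LogDomain w → Nonzero w
    domain⇒nonzero {w} (upper p) = squares-pos (re w) (im w) p
    domain⇒nonzero {w} (lower p) = pos-resp
      (solve 2 (λ u v → u :* u :+ (:- v) :* (:- v) := u :* u :+ v :* v) refl (re w) (im w))
      (squares-pos (re w) (- im w) (neg⇒pos p))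
    domain⇒nonzero {w} (axis _ q) with #⇒<⊎> q
    ... | inj₂ p = pos-resp (+-comm _ _) (squares-pos (im w) (re w) p)
    ... | inj₁ p = pos-resp
      (solve 2 (λ u v → v :* v :+ (:- u) :* (:- u) := u :* u :+ v :* v) refl (re w) (im w))
      (squares-pos (im w) (- re w) (neg⇒pos p))

    denominator-nonzero : ∀ M τ → Nonzero (denominator M τ)
    denominator-nonzero M τ = domain⇒nonzero (denominator-domain M τ)

  numerator : SL₂ℤ → ℍ → ℂ
  numerator (mat a b _ _ _) τ = int a *ᶜ val τ +ᶜ int b

  möbius : SL₂ℤ → ℍ → ℂ
  möbius M τ = numerator M τ /ᶜ denominator M τ ⟨ denominator-nonzero M τ ⟩

  opaque
    det-real : ∀ a b c d → a ℤ.* d ℤ.- b ℤ.* c ≡ 1ℤ → fromℤ a * fromℤ d - fromℤ b * fromℤ c ≈ 1#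
    det-real a b c d det = begin
      fromℤ a * fromℤ d - fromℤ b * fromℤ c       ≈⟨ +-cong (fromℤ-* a d) (-‿cong (fromℤ-* b c)) ⟨
      fromℤ (a ℤ.* d) - fromℤ (b ℤ.* c)           ≈⟨ +-congˡ (fromℤ-neg (b ℤ.* c)) ⟨
      fromℤ (a ℤ.* d) + fromℤ (ℤ.- (b ℤ.* c))     ≈⟨ fromℤ-+ (a ℤ.* d) (ℤ.- (b ℤ.* c)) ⟨
      fromℤ (a ℤ.* d ℤ.- b ℤ.* c)                 ≡⟨ ≡.cong fromℤ det ⟩
      1#                                          ∎
      where open import Relation.Binary.Reasoning.Setoid setoid

    im-möbius>0 : ∀ M τ → 0# < im (möbius M τ)
    im-möbius>0 M@(mat a b c d det) τ = pos-resp
      (trans (sym (*-identityˡ _))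
        (trans (*-congʳ (sym (det-real a b c d (recompute (_ ℤ.≟ _) det))))
          (solve 7 (λ a b c d u v s →
            (a :* d :- b :* c) :* (v :* s) :=
            ((a :* u :- con 0ℤ :* v) :+ b) :* (:- ((c :* v :+ con 0ℤ :* u) :+ con 0ℤ) :* s)
              :+ ((a :* v :+ con 0ℤ :* u) :+ con 0ℤ) :* (((c :* u :- con 0ℤ :* v) :+ d) :* s))
            refl (fromℤ a) (fromℤ b) (fromℤ c) (fromℤ d) (re (val τ)) (im (val τ)) s)))
      (*-pos (im>0 τ) (1/-pos _ (denominator-nonzero M τ)))
      where
      s : ℝ
      s = 1/ ∥ denominator M τ ∥² (denominator-nonzero M τ)

  infixr 6 _◂_
  _◂_ : Γᴶ → ℍ × ℂ → ℍ × ℂ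
  [ M , λ′ , μ ] ◂ (τ , z) =
    (möbius M τ , im-möbius>0 M τ) ,
    (z +ᶜ int λ′ *ᶜ val τ +ᶜ int μ) /ᶜ denominator M τ ⟨ denominator-nonzero M τ ⟩

  j : ℝ → ℝ → Γᴶ → ℍ × ℂ → ℂ
  j k m [ M , λ′ , μ ] (τ , z) =
    denominator M τ ^ᶜ real (- k) ⟨ denominator-domain M τ ⟩
    *ᶜ exp (real (fromℕ 2 * π) *ᶜ i *ᶜ real m *ᶜ
         (-ᶜ (int (₂₁ M) *ᶜ (w *ᶜ w) /ᶜ denominator M τ ⟨ denominator-nonzero M τ ⟩)
           +ᶜ int λ′ *ᶜ int λ′ *ᶜ val τ
           +ᶜ int (+ 2) *ᶜ int λ′ *ᶜ z
           +ᶜ int λ′ *ᶜ int μ))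
    where
    w : ℂ
    w = z +ᶜ int λ′ *ᶜ val τ +ᶜ int μ

  opaque
    denominator-cong : ∀ M {τ τ′} → val τ ≈ᶜ val τ′ → denominator M τ ≈ᶜ denominator M τ′
    denominator-cong (mat _ _ _ _ _) p = +ᶜ-cong (*ᶜ-cong reflᶜ p) reflᶜ

    numerator-cong : ∀ M {τ τ′} → val τ ≈ᶜ val τ′ → numerator M τ ≈ᶜ numerator M τ′
    numerator-cong (mat _ _ _ _ _) p = +ᶜ-cong (*ᶜ-cong reflᶜ p) reflᶜ

  open Setoid Points using () renaming (_≈_ to _≈ₚ_)

  opaque
    ◂-cong : ∀ γ {p q} → p ≈ₚ q → γ ◂ p ≈ₚ γ ◂ q
    ◂-cong [ M , λ′ , μ ] {τ , z} {τ′ , z′} (τ≈ , z≈) =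
      /ᶜ-cong (denominator-nonzero M τ) (denominator-nonzero M τ′) (numerator-cong M {τ} {τ′} τ≈) (denominator-cong M {τ} {τ′} τ≈) ,
      /ᶜ-cong (denominator-nonzero M τ) (denominator-nonzero M τ′)
        (+ᶜ-cong (+ᶜ-cong z≈ (*ᶜ-cong reflᶜ τ≈)) reflᶜ) (denominator-cong M {τ} {τ′} τ≈)

    j-cong : ∀ k m γ {p q} → p ≈ₚ q → j k m γ p ≈ᶜ j k m γ q
    j-cong k m [ M , λ′ , μ ] {τ , z} {τ′ , z′} (τ≈ , z≈) = *ᶜ-cong
      (exp-cong (*ᶜ-cong reflᶜ (log-cong (denominator-domain M τ) (denominator-domain M τ′) d≈)))
      (exp-cong (*ᶜ-cong reflᶜ
        (+ᶜ-cong (+ᶜ-cong (+ᶜ-cong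
          (-ᶜ-cong (/ᶜ-cong (denominator-nonzero M τ) (denominator-nonzero M τ′) (*ᶜ-cong reflᶜ (*ᶜ-cong w≈ w≈)) d≈))
          (*ᶜ-cong reflᶜ τ≈)) (*ᶜ-cong reflᶜ z≈)) reflᶜ)))
      where
      d≈ : denominator M τ ≈ᶜ denominator M τ′
      d≈ = denominator-cong M {τ} {τ′} τ≈
      w≈ : z +ᶜ int λ′ *ᶜ val τ +ᶜ int μ ≈ᶜ z′ +ᶜ int λ′ *ᶜ val τ′ +ᶜ int μ
      w≈ = +ᶜ-cong (+ᶜ-cong z≈ (*ᶜ-cong reflᶜ τ≈)) reflᶜ

  Functions : Set (c ⊔ ℓ₁ ⊔ ℓ₂)
  Functions = Func Points ℂ-setoid

  open Func using (to; cong)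

  infix 4 _≐_
  _≐_ : Functions → Functions → Set (c ⊔ ℓ₁ ⊔ ℓ₂)
  f ≐ g = ∀ p → to f p ≈ᶜ to g p

  infixl 6 _⊕_
  infix  8 ⊝_
  _⊕_ : Functions → Functions → Functions
  f ⊕ g = record { to = λ p → to f p +ᶜ to g p ; cong = λ p≈q → +ᶜ-cong (cong f p≈q) (cong g p≈q) }

  ⊝_ : Functions → Functions
  ⊝ f = record { to = λ p → -ᶜ to f p ; cong = λ p≈q → -ᶜ-cong (cong f p≈q) }

  𝟘 : Functions
  𝟘 = record { to = λ _ → 0ᶜ ; cong = λ _ → reflᶜ }

  -- Fréchet differentiability over ℂ at every point, in the Euclidean norm of ℂ².
  IsHolomorphic : Functions → Set (c ⊔ ℓ₂)
  IsHolomorphic f = ∀ p → ∃ λ ∂τ → ∃ λ ∂z → ∀ ε → 0# < ε → ∃ λ δ → 0# < δ × (∀ q →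
    let Δτ = val (proj₁ q) -ᶜ val (proj₁ p)
        Δz = proj₂ q -ᶜ proj₂ p
        r² = ∥ Δτ ∥² + ∥ Δz ∥²
    in r² < δ * δ → ∥ to f q -ᶜ to f p -ᶜ (∂τ *ᶜ Δτ +ᶜ ∂z *ᶜ Δz) ∥² ≤ ε * ε * r²)

  -- Unconditional convergence: the net of finite partial sums of a tends to s.
  HasSum : {A : Set} → (A → ℂ) → ℂ → Set (c ⊔ ℓ₂)
  HasSum {A} a s = ∀ ε → 0# < ε → ∃ λ (F : List A) → ∀ G → Unique G → F ⊆ G →
    ∣ foldr _+ᶜ_ 0ᶜ (map a G) -ᶜ s ∣ᶜ< ε

  monomial : ℂ → ℂ → ℕ × ℕ × ℕ × ℕ → ℝ
  monomial Δτ Δz (α₁ , α₂ , α₃ , α₄) = re Δτ ^ α₁ * im Δτ ^ α₂ * re Δz ^ α₃ * im Δz ^ α₄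

  -- Near every point, f is the sum of a power series in the four real coordinates.
  IsRealAnalytic : Functions → Set (c ⊔ ℓ₂)
  IsRealAnalytic f = ∀ p → ∃ λ (a : ℕ × ℕ × ℕ × ℕ → ℂ) → ∃ λ r → 0# < r × (∀ q →
    let Δτ = val (proj₁ q) -ᶜ val (proj₁ p)
        Δz = proj₂ q -ᶜ proj₂ p
    in ∣ re Δτ ∣< r → ∣ im Δτ ∣< r → ∣ re Δz ∣< r → ∣ im Δz ∣< r →
       HasSum (λ α → a α *ᶜ real (monomial Δτ Δz α)) (to f q))

  -- exp (2πm y² / v)
  gauss : ℝ → ℍ × ℂ → ℝ
  gauss m (τ , z) = expᴿ (fromℕ 2 * π * m * (im z * im z) * 1/ (im (val τ)) (im>0 τ))

  record _∈𝒫_ (f : Functions) (m : ℝ) : Set (c ⊔ ℓ₁ ⊔ ℓ₂) where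
    field
      holomorphic : IsHolomorphic f
      K ρ σ       : ℝ
      K>0         : 0# < K
      ρ>0         : 0# < ρ
      σ>0         : 0# < σ
      growth      : ∀ p → let τ = proj₁ p in
        ∣ to f p ∣ᶜ< K * (∣ val τ ∣^ ρ ⟨ upper (im>0 τ) ⟩ + im (val τ) ^ᴿ - σ ⟨ im>0 τ ⟩) * gauss m p

  record MultiplierSystem (k m : ℝ) : Set (c ⊔ ℓ₁ ⊔ ℓ₂) where
    field
      ω         : Γᴶ → ℂ
      ω-nonzero : ∀ γ → Nonzero (ω γ)
      ω-cocycle : ∀ γ₁ γ₂ p →
        ω (γ₁ ∙ᴶ γ₂) *ᶜ j k m (γ₁ ∙ᴶ γ₂) p ≈ᶜ ω γ₁ *ᶜ ω γ₂ *ᶜ j k m γ₁ (γ₂ ◂ p) *ᶜ j k m γ₂ p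

  open MultiplierSystem public

  infixl 7 _∣[_]_
  _∣[_]_ : Functions → ∀ {k m} → MultiplierSystem k m → Γᴶ → Functions
  _∣[_]_ f {k} {m} Ω γ = record
    { to   = λ p → ω Ω γ *ᶜ j k m γ p *ᶜ to f (γ ◂ p)
    ; cong = λ {p} {q} p≈q → *ᶜ-cong (*ᶜ-cong reflᶜ (j-cong k m γ {p} {q} p≈q)) (cong f (◂-cong γ {p} {q} p≈q))
    }

  -- P γ are the period functions; decay is uniform in the real parts of τ and z.
  record JacobiIntegral {k m : ℝ} (Ω : MultiplierSystem k m) : Set (c ⊔ ℓ₁ ⊔ ℓ₂) where
    field
      f          : Functions
      analytic   : IsRealAnalytic f
      P          : Γᴶ → Functions
      transform  : ∀ γ → f ∣[ Ω ] γ ≐ f ⊕ P γ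
      P∈𝒫        : ∀ γ → P γ ∈𝒫 m
      periodic-z : P [ I , 0ℤ , 1ℤ ] ≐ 𝟘
      periodic-τ : ∃ λ (ℓ : ℤ) → P [ S ^ᴹ ℓ , 0ℤ , 0ℤ ] ≐ 𝟘
      decay      : ∀ ε → 0# < ε → ∃ λ Y → ∀ p → let τ = proj₁ p; z = proj₂ p in
        Y < im (val τ) → Y < im z →
        ∣ to f p *ᶜ real (im (val τ) ^ᴿ - (½ * k) ⟨ im>0 τ ⟩ * gauss m p) ∣ᶜ< ε

  HalfInteger : ℝ → Set ℓ₁
  HalfInteger k = ∃ λ n → fromℕ 2 * k ≈ fromℤ n

{-# OPTIONS --safe #-}
-- The slash operator is a right action, so γ ↦ P γ is a cocycle:
-- P (γ₁ γ₂) = P γ₁ ∣ γ₂ + P γ₂. Its zero set is thus a subgroup, containing [-I, 0],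
-- [S, 0] and [I, (0, 1)] by hypothesis, and P γ depends only on the coset
-- H γ of this subgroup H. Each of the six relations is then the cocycle identity
-- for one relation in the Jacobi group.
module Submission where

open import Defs
open import Algebra.Bundles using (CommutativeRing)
import Algebra.Properties.AbelianGroup
import Algebra.Solver.Ring.NaturalCoefficients.Default
open import Data.Integer.Base as ℤ using (ℤ; 0ℤ; 1ℤ; -1ℤ; +_)
open import Data.Product.Base using (_×_; _,_)
open import Function.Bundles using (Func)
open import Relation.Binary.Bundles using (Setoid)
import Relation.Binary.Reasoning.Setoid

-- The complex numbers as a commutative ring, with division.

module ComplexField {c ℓ₁ ℓ₂} (R : RealField c ℓ₁ ℓ₂) where

  open RealAnalysis R
  open Solver using (solve; _:+_; _:*_; _:-_; :-_; _:=_; con)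

  -- Additive laws hold coordinatewise; each multiplicative law is a pair of real polynomial
  -- identities. The bundle gives access to cancellation and to a solver.
  ℂ-commutativeRing : CommutativeRing c ℓ₁
  ℂ-commutativeRing = record
    { Carrier = ℂ ; _≈_ = _≈ᶜ_ ; _+_ = _+ᶜ_ ; _*_ = _*ᶜ_ ; -_ = -ᶜ_ ; 0# = 0ᶜ ; 1# = 1ᶜ
    ; isCommutativeRing = record
      { isRing = record
        { +-isAbelianGroup = record
          { isGroup = record
            { isMonoid = record
              { isSemigroup = record
                { isMagma = record
                  { isEquivalence = Setoid.isEquivalence ℂ-setoid
                  ; ∙-cong        = +ᶜ-cong
                  }
                ; assoc = λ _ _ _ → +-assoc _ _ _ , +-assoc _ _ _
                }
              ; identity = (λ _ → +-identityˡ _ , +-identityˡ _) , (λ _ → +-identityʳ _ , +-identityʳ _)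
              }
            ; inverse = (λ _ → -‿inverseˡ _ , -‿inverseˡ _) , (λ _ → -‿inverseʳ _ , -‿inverseʳ _)
            ; ⁻¹-cong = -ᶜ-cong
            }
          ; comm = λ _ _ → +-comm _ _ , +-comm _ _
          }
        ; *-cong     = *ᶜ-cong
        ; *-assoc    = *ᶜ-assoc
        ; *-identity = *ᶜ-identityˡ , λ z → transᶜ (*ᶜ-comm z 1ᶜ) (*ᶜ-identityˡ z)
        ; distrib    = distribᶜˡ , λ z u w →
            transᶜ (*ᶜ-comm (u +ᶜ w) z) (transᶜ (distribᶜˡ z u w) (+ᶜ-cong (*ᶜ-comm z u) (*ᶜ-comm z w)))
        }
      ; *-comm = *ᶜ-comm
      }
    }
    where
    *ᶜ-assoc : ∀ z u w → z *ᶜ u *ᶜ w ≈ᶜ z *ᶜ (u *ᶜ w)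
    *ᶜ-assoc (z₁ +i z₂) (u₁ +i u₂) (w₁ +i w₂) =
      solve 6 (λ a b c d e f → (a :* c :- b :* d) :* e :- (a :* d :+ b :* c) :* f
        := a :* (c :* e :- d :* f) :- b :* (c :* f :+ d :* e)) refl z₁ z₂ u₁ u₂ w₁ w₂ ,
      solve 6 (λ a b c d e f → (a :* c :- b :* d) :* f :+ (a :* d :+ b :* c) :* e
        := a :* (c :* f :+ d :* e) :+ b :* (c :* e :- d :* f)) refl z₁ z₂ u₁ u₂ w₁ w₂
    *ᶜ-comm : ∀ z w → z *ᶜ w ≈ᶜ w *ᶜ z
    *ᶜ-comm (z₁ +i z₂) (w₁ +i w₂) =
      solve 4 (λ a b c d → a :* c :- b :* d := c :* a :- d :* b) refl z₁ z₂ w₁ w₂ ,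
      solve 4 (λ a b c d → a :* d :+ b :* c := c :* b :+ d :* a) refl z₁ z₂ w₁ w₂
    *ᶜ-identityˡ : ∀ z → 1ᶜ *ᶜ z ≈ᶜ z
    *ᶜ-identityˡ (x +i y) =
      solve 2 (λ x y → con 1ℤ :* x :- con 0ℤ :* y := x) refl x y ,
      solve 2 (λ x y → con 1ℤ :* y :+ con 0ℤ :* x := y) refl x y
    distribᶜˡ : ∀ z u w → z *ᶜ (u +ᶜ w) ≈ᶜ z *ᶜ u +ᶜ z *ᶜ w
    distribᶜˡ (z₁ +i z₂) (u₁ +i u₂) (w₁ +i w₂) =
      solve 6 (λ a b c d e f → a :* (c :+ e) :- b :* (d :+ f)
        := (a :* c :- b :* d) :+ (a :* e :- b :* f)) refl z₁ z₂ u₁ u₂ w₁ w₂ ,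
      solve 6 (λ a b c d e f → a :* (d :+ f) :+ b :* (c :+ e)
        := (a :* d :+ b :* c) :+ (a :* f :+ b :* e)) refl z₁ z₂ u₁ u₂ w₁ w₂

  open CommutativeRing ℂ-commutativeRing public
    using (commutativeSemiring)
    renaming ( +-abelianGroup to +ᶜ-abelianGroup; +-identityˡ to +ᶜ-identityˡ; +-identityʳ to +ᶜ-identityʳ
             ; +-comm to +ᶜ-comm; *-assoc to *ᶜ-assoc; *-comm to *ᶜ-comm; *-identityʳ to *ᶜ-identityʳ
             ; zeroʳ to zeroᶜʳ; distribˡ to distribᶜˡ)

  open Algebra.Properties.AbelianGroup +ᶜ-abelianGroup public
    using () renaming (∙-cancelˡ to +ᶜ-cancelˡ; xyx⁻¹≈y to x+y-x≈y)

  -- This solver knows only natural coefficients, so every identity handed to it is free of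
  -- negation; the two relations with a minus sign go through `x+y-x≈y` instead.
  module ℂ-Solver = Algebra.Solver.Ring.NaturalCoefficients.Default commutativeSemiring

  opaque
    int-+ : ∀ a b → int (a ℤ.+ b) ≈ᶜ int a +ᶜ int b
    int-+ a b = fromℤ-+ a b , sym (+-identityʳ 0#)

    int-* : ∀ a b → int (a ℤ.* b) ≈ᶜ int a *ᶜ int b
    int-* a b = trans (fromℤ-* a b) (solve 1 (λ x → x := x :- con 0ℤ :* con 0ℤ) refl _) ,
      solve 2 (λ x y → con 0ℤ := x :* con 0ℤ :+ con 0ℤ :* y) refl (fromℤ a) (fromℤ b)

    -- The shape of an entry of a matrix product: it carries the integer group law over to complex
    -- coefficients.
    int-bilinear : ∀ a b c d → int (a ℤ.* b ℤ.+ c ℤ.* d) ≈ᶜ int a *ᶜ int b +ᶜ int c *ᶜ int d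
    int-bilinear a b c d = transᶜ (int-+ (a ℤ.* b) (c ℤ.* d)) (+ᶜ-cong (int-* a b) (int-* c d))

    -- Division is multiplication by the conjugate of `w` over `∥ w ∥²`, and the conjugate times `w`
    -- is `∥ w ∥²`.
    /ᶜ-*ᶜ-cancel : ∀ z w (w≢0 : Nonzero w) → z /ᶜ w ⟨ w≢0 ⟩ *ᶜ w ≈ᶜ z
    /ᶜ-*ᶜ-cancel z w w≢0 = transᶜ (*ᶜ-assoc z _ w) (transᶜ (*ᶜ-cong reflᶜ inverse) (*ᶜ-identityʳ z))
      where
      s : ℝ
      s = 1/ ∥ w ∥² w≢0
      inverse : (re w * s +i - im w * s) *ᶜ w ≈ᶜ 1ᶜ
      inverse =
        trans (solve 3 (λ x y s → (x :* s) :* x :- (:- y :* s) :* y := s :* (x :* x :+ y :* y)) refl (re w) (im w) s)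
          (1/-inverseˡ ∥ w ∥² w≢0) ,
        solve 3 (λ x y s → (x :* s) :* y :+ (:- y :* s) :* x := con 0ℤ) refl (re w) (im w) s

    -- Reduces an equation with a quotient to one between products, which needs no inverses.
    /ᶜ-unique : ∀ {x z w} (w≢0 : Nonzero w) → x *ᶜ w ≈ᶜ z → x ≈ᶜ z /ᶜ w ⟨ w≢0 ⟩
    /ᶜ-unique {x} {z} {w} w≢0 xw≈z = begin
      x                         ≈⟨ /ᶜ-*ᶜ-cancel x w w≢0 ⟨
      x *ᶜ w⁻¹ *ᶜ w             ≈⟨ *ᶜ-assoc x w⁻¹ w ⟩
      x *ᶜ (w⁻¹ *ᶜ w)           ≈⟨ *ᶜ-cong reflᶜ (*ᶜ-comm w⁻¹ w) ⟩
      x *ᶜ (w *ᶜ w⁻¹)           ≈⟨ *ᶜ-assoc x w w⁻¹ ⟨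
      x *ᶜ w *ᶜ w⁻¹             ≈⟨ *ᶜ-cong xw≈z reflᶜ ⟩
      z *ᶜ w⁻¹                  ∎
      where
      open Relation.Binary.Reasoning.Setoid ℂ-setoid
      w⁻¹ : ℂ
      w⁻¹ = re w * 1/ ∥ w ∥² w≢0 +i - im w * 1/ ∥ w ∥² w≢0

    -- Expanding a fraction by `e`: this clears the inner denominator of a composed Möbius
    -- transformation.
    /ᶜ-/ᶜ : ∀ {n d n′ d′ e} (d≢0 : Nonzero d) (d′≢0 : Nonzero d′) →
      n *ᶜ e ≈ᶜ n′ → d *ᶜ e ≈ᶜ d′ → n′ /ᶜ d′ ⟨ d′≢0 ⟩ ≈ᶜ n /ᶜ d ⟨ d≢0 ⟩
    /ᶜ-/ᶜ {n} {d} {n′} {d′} {e} d≢0 d′≢0 ne≈n′ de≈d′ = symᶜ (/ᶜ-unique d′≢0 (begin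
      n /ᶜ d ⟨ d≢0 ⟩ *ᶜ d′          ≈⟨ *ᶜ-cong reflᶜ de≈d′ ⟨
      n /ᶜ d ⟨ d≢0 ⟩ *ᶜ (d *ᶜ e)    ≈⟨ *ᶜ-assoc _ d e ⟨
      n /ᶜ d ⟨ d≢0 ⟩ *ᶜ d *ᶜ e      ≈⟨ *ᶜ-cong (/ᶜ-*ᶜ-cancel n d d≢0) reflᶜ ⟩
      n *ᶜ e                        ≈⟨ ne≈n′ ⟩
      n′                            ∎))
      where open Relation.Binary.Reasoning.Setoid ℂ-setoid

-- The action of the Jacobi group on points, and the slash operator as a right action.

module SlashAction {c ℓ₁ ℓ₂} (R : RealField c ℓ₁ ℓ₂) (B : RealAnalysis.LogBranch R) where

  open RealAnalysis R
  open JacobiForms R B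
  open ComplexField R
  open ℍ using (val)
  open Setoid Points using () renaming (_≈_ to _≈ₚ_; sym to symₚ)
  open Relation.Binary.Reasoning.Setoid ℂ-setoid
  open Func using (to; cong)

  opaque
    -- Here `q` is (at + b)/(ct + d). Clearing this denominator in αq + β multiplies the row vector
    -- (α, β) by the matrix, so one lemma serves the numerator row, the denominator row and the
    -- translation (λ, μ).
    affine-∘ : ∀ α β a b c d {t q} → q *ᶜ (int c *ᶜ t +ᶜ int d) ≈ᶜ int a *ᶜ t +ᶜ int b →
      (int α *ᶜ q +ᶜ int β) *ᶜ (int c *ᶜ t +ᶜ int d)
        ≈ᶜ int (α ℤ.* a ℤ.+ β ℤ.* c) *ᶜ t +ᶜ int (α ℤ.* b ℤ.+ β ℤ.* d)
    affine-∘ α β a b c d {t} {q} eq = begin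
      (int α *ᶜ q +ᶜ int β) *ᶜ D
        ≈⟨ solve 4 (λ A q B D → (A :* q :+ B) :* D := A :* (q :* D) :+ B :* D) reflᶜ (int α) q (int β) D ⟩
      int α *ᶜ (q *ᶜ D) +ᶜ int β *ᶜ D
        ≈⟨ +ᶜ-cong (*ᶜ-cong reflᶜ eq) reflᶜ ⟩
      int α *ᶜ (int a *ᶜ t +ᶜ int b) +ᶜ int β *ᶜ D
        ≈⟨ solve 7 (λ A B a b c d t → A :* (a :* t :+ b) :+ B :* (c :* t :+ d)
             := (A :* a :+ B :* c) :* t :+ (A :* b :+ B :* d)) reflᶜ
             (int α) (int β) (int a) (int b) (int c) (int d) t ⟩
      (int α *ᶜ int a +ᶜ int β *ᶜ int c) *ᶜ t +ᶜ (int α *ᶜ int b +ᶜ int β *ᶜ int d)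
        ≈⟨ +ᶜ-cong (*ᶜ-cong (int-bilinear α a β c) reflᶜ) (int-bilinear α b β d) ⟨
      int (α ℤ.* a ℤ.+ β ℤ.* c) *ᶜ t +ᶜ int (α ℤ.* b ℤ.+ β ℤ.* d) ∎
      where
      open ℂ-Solver using (solve; _:+_; _:*_; _:=_)
      D : ℂ
      D = int c *ᶜ t +ᶜ int d

    -- The elliptic analogue, with `w` the image of `z`: the coefficients that appear are those of
    -- (λ₁, μ₁)M₂ + (λ₂, μ₂), the translation part of the group law.
    translated-affine-∘ : ∀ λ₁ μ₁ λ₂ μ₂ a b c d {t z q w} →
      q *ᶜ (int c *ᶜ t +ᶜ int d) ≈ᶜ int a *ᶜ t +ᶜ int b →
      w *ᶜ (int c *ᶜ t +ᶜ int d) ≈ᶜ z +ᶜ int λ₂ *ᶜ t +ᶜ int μ₂ →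
      (w +ᶜ int λ₁ *ᶜ q +ᶜ int μ₁) *ᶜ (int c *ᶜ t +ᶜ int d)
        ≈ᶜ z +ᶜ int (λ₁ ℤ.* a ℤ.+ μ₁ ℤ.* c ℤ.+ λ₂) *ᶜ t +ᶜ int (λ₁ ℤ.* b ℤ.+ μ₁ ℤ.* d ℤ.+ μ₂)
    translated-affine-∘ λ₁ μ₁ λ₂ μ₂ a b c d {t} {z} {q} {w} qD≈N wD≈Z = begin
      (w +ᶜ int λ₁ *ᶜ q +ᶜ int μ₁) *ᶜ D
        ≈⟨ solve 4 (λ w x y D → (w :+ x :+ y) :* D := w :* D :+ (x :+ y) :* D) reflᶜ w (int λ₁ *ᶜ q) (int μ₁) D ⟩
      w *ᶜ D +ᶜ (int λ₁ *ᶜ q +ᶜ int μ₁) *ᶜ D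
        ≈⟨ +ᶜ-cong wD≈Z (affine-∘ λ₁ μ₁ a b c d qD≈N) ⟩
      z +ᶜ int λ₂ *ᶜ t +ᶜ int μ₂ +ᶜ (λ′ *ᶜ t +ᶜ μ′)
        -- The transformed translation goes before `λ₂` and `μ₂`, in the order of summands fixed by
        -- `_∙ᴶ_`.
        ≈⟨ solve 6 (λ z l m t l′ m′ → z :+ l :* t :+ m :+ (l′ :* t :+ m′)
             := z :+ (l′ :+ l) :* t :+ (m′ :+ m)) reflᶜ z (int λ₂) (int μ₂) t λ′ μ′ ⟩
      z +ᶜ (λ′ +ᶜ int λ₂) *ᶜ t +ᶜ (μ′ +ᶜ int μ₂)
        ≈⟨ +ᶜ-cong (+ᶜ-cong reflᶜ (*ᶜ-cong (int-+ (λ₁ ℤ.* a ℤ.+ μ₁ ℤ.* c) λ₂) reflᶜ))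
             (int-+ (λ₁ ℤ.* b ℤ.+ μ₁ ℤ.* d) μ₂) ⟨
      z +ᶜ int (λ₁ ℤ.* a ℤ.+ μ₁ ℤ.* c ℤ.+ λ₂) *ᶜ t +ᶜ int (λ₁ ℤ.* b ℤ.+ μ₁ ℤ.* d ℤ.+ μ₂) ∎
      where
      open ℂ-Solver using (solve; _:+_; _:*_; _:=_)
      D λ′ μ′ : ℂ
      D  = int c *ᶜ t +ᶜ int d
      λ′ = int (λ₁ ℤ.* a ℤ.+ μ₁ ℤ.* c)
      μ′ = int (λ₁ ℤ.* b ℤ.+ μ₁ ℤ.* d)

    ◂-∙ᴶ : ∀ γ₁ γ₂ p → (γ₁ ∙ᴶ γ₂) ◂ p ≈ₚ γ₁ ◂ γ₂ ◂ p
    ◂-∙ᴶ [ M₁@(mat a₁ b₁ c₁ d₁ _) , λ₁ , μ₁ ] [ M₂@(mat a b c d _) , λ₂ , μ₂ ] (τ , z) =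
      -- Both coordinates are expanded by `D` = cτ + d. The denominators agree by the cocycle
      -- property of cτ + d, which is `affine-∘` for the lower row of `M₁`.
      /ᶜ-/ᶜ {e = D} d≢0 d′≢0 (affine-∘ a₁ b₁ a b c d qD≈N) (affine-∘ c₁ d₁ a b c d qD≈N) ,
      /ᶜ-/ᶜ {e = D} d≢0 d′≢0
        (translated-affine-∘ λ₁ μ₁ λ₂ μ₂ a b c d qD≈N (/ᶜ-*ᶜ-cancel _ D D≢0)) (affine-∘ c₁ d₁ a b c d qD≈N)
      where
      D : ℂ
      D = denominator M₂ τ
      D≢0 : Nonzero D
      D≢0 = denominator-nonzero M₂ τ
      τ′ : ℍ
      τ′ = möbius M₂ τ , im-möbius>0 M₂ τ
      qD≈N : möbius M₂ τ *ᶜ D ≈ᶜ numerator M₂ τ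
      qD≈N = /ᶜ-*ᶜ-cancel (numerator M₂ τ) D D≢0
      d≢0 : Nonzero (denominator M₁ τ′)
      d≢0 = denominator-nonzero M₁ τ′
      d′≢0 : Nonzero (denominator (M₁ ∙ M₂) τ)
      d′≢0 = denominator-nonzero (M₁ ∙ M₂) τ

  module _ {k m : ℝ} (Ω : MultiplierSystem k m) where

    opaque
      ∣-cong : ∀ {f g} γ → f ≐ g → f ∣[ Ω ] γ ≐ g ∣[ Ω ] γ
      ∣-cong γ f≐g p = *ᶜ-cong reflᶜ (f≐g (γ ◂ p))

      ∣-⊕ : ∀ f g γ → (f ⊕ g) ∣[ Ω ] γ ≐ f ∣[ Ω ] γ ⊕ g ∣[ Ω ] γ
      ∣-⊕ f g γ p = distribᶜˡ _ _ _

      ∣-𝟘 : ∀ γ → 𝟘 ∣[ Ω ] γ ≐ 𝟘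
      ∣-𝟘 γ p = zeroᶜʳ _

      -- The multiplier axiom compares products of `ω` and `j`, so the jumps of the chosen branch
      -- are already absorbed; it remains to compose the actions on points and reorder factors.
      ∣-∙ᴶ : ∀ f γ₁ γ₂ → f ∣[ Ω ] (γ₁ ∙ᴶ γ₂) ≐ f ∣[ Ω ] γ₁ ∣[ Ω ] γ₂
      ∣-∙ᴶ f γ₁ γ₂ p = begin
        ω Ω (γ₁ ∙ᴶ γ₂) *ᶜ j k m (γ₁ ∙ᴶ γ₂) p *ᶜ to f ((γ₁ ∙ᴶ γ₂) ◂ p)
          ≈⟨ *ᶜ-cong (ω-cocycle Ω γ₁ γ₂ p) (cong f (◂-∙ᴶ γ₁ γ₂ p)) ⟩
        ω Ω γ₁ *ᶜ ω Ω γ₂ *ᶜ j k m γ₁ (γ₂ ◂ p) *ᶜ j k m γ₂ p *ᶜ to f (γ₁ ◂ γ₂ ◂ p)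
          ≈⟨ solve 5 (λ w₁ w₂ j₁ j₂ x → w₁ :* w₂ :* j₁ :* j₂ :* x := w₂ :* j₂ :* (w₁ :* j₁ :* x)) reflᶜ
               (ω Ω γ₁) (ω Ω γ₂) (j k m γ₁ (γ₂ ◂ p)) (j k m γ₂ p) (to f (γ₁ ◂ γ₂ ◂ p)) ⟩
        ω Ω γ₂ *ᶜ j k m γ₂ p *ᶜ (ω Ω γ₁ *ᶜ j k m γ₁ (γ₂ ◂ p) *ᶜ to f (γ₁ ◂ γ₂ ◂ p)) ∎
        where open ℂ-Solver using (solve; _:*_; _:=_)

  -- The cocycle of period functions.

  module PeriodRelations {k m : ℝ} {Ω : MultiplierSystem k m} (J : JacobiIntegral Ω) where

    open JacobiIntegral J

    opaque
      -- Transform `f` by the product at once and by the two factors in turn, then cancel `f`.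
      P-cocycle : ∀ γ₁ γ₂ → P (γ₁ ∙ᴶ γ₂) ≐ P γ₁ ∣[ Ω ] γ₂ ⊕ P γ₂
      P-cocycle γ₁ γ₂ p = +ᶜ-cancelˡ (to f p) _ _ (begin
        to f p +ᶜ to (P (γ₁ ∙ᴶ γ₂)) p                           ≈⟨ transform (γ₁ ∙ᴶ γ₂) p ⟨
        to (f ∣[ Ω ] (γ₁ ∙ᴶ γ₂)) p                              ≈⟨ ∣-∙ᴶ Ω f γ₁ γ₂ p ⟩
        to (f ∣[ Ω ] γ₁ ∣[ Ω ] γ₂) p                            ≈⟨ ∣-cong Ω {f ∣[ Ω ] γ₁} {f ⊕ P γ₁} γ₂ (transform γ₁) p ⟩
        to ((f ⊕ P γ₁) ∣[ Ω ] γ₂) p                             ≈⟨ ∣-⊕ Ω f (P γ₁) γ₂ p ⟩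
        to (f ∣[ Ω ] γ₂) p +ᶜ to (P γ₁ ∣[ Ω ] γ₂) p             ≈⟨ +ᶜ-cong (transform γ₂ p) reflᶜ ⟩
        to f p +ᶜ to (P γ₂) p +ᶜ to (P γ₁ ∣[ Ω ] γ₂) p
          ≈⟨ solve 3 (λ x y z → x :+ y :+ z := x :+ (z :+ y)) reflᶜ _ _ _ ⟩
        to f p +ᶜ (to (P γ₁ ∣[ Ω ] γ₂) p +ᶜ to (P γ₂) p)        ∎)
        where open ℂ-Solver using (solve; _:+_; _:=_)

      P-left-invariant : ∀ γ₁ γ₂ → P γ₁ ≐ 𝟘 → P (γ₁ ∙ᴶ γ₂) ≐ P γ₂
      P-left-invariant γ₁ γ₂ Pγ₁≐𝟘 p = begin
        to (P (γ₁ ∙ᴶ γ₂)) p                         ≈⟨ P-cocycle γ₁ γ₂ p ⟩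
        to (P γ₁ ∣[ Ω ] γ₂) p +ᶜ to (P γ₂) p        ≈⟨ +ᶜ-cong (∣-cong Ω {P γ₁} {𝟘} γ₂ Pγ₁≐𝟘 p) reflᶜ ⟩
        to (𝟘 ∣[ Ω ] γ₂) p +ᶜ to (P γ₂) p           ≈⟨ +ᶜ-cong (∣-𝟘 Ω γ₂ p) reflᶜ ⟩
        0ᶜ +ᶜ to (P γ₂) p                           ≈⟨ +ᶜ-identityˡ _ ⟩
        to (P γ₂) p                                 ∎

    -- Six relations from products in the Jacobi group.

    module _ (P-S : P [ S , 0ℤ , 0ℤ ] ≐ 𝟘) (P--I : P [ -I , 0ℤ , 0ℤ ] ≐ 𝟘) (P-01 : P [ I , 0ℤ , 1ℤ ] ≐ 𝟘) where

      private
        h P-T : Functions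
        h   = P [ I , 1ℤ , 0ℤ ]
        P-T = P [ T , 0ℤ , 0ℤ ]

        ST : SL₂ℤ
        ST = S ∙ T

      opaque
        P[I,0,0]≐𝟘 : P [ I , 0ℤ , 0ℤ ] ≐ 𝟘
        -- The square of [-I, 0] is [I, 0] by evaluation alone: all entries are closed integers and
        -- the determinant proofs are irrelevant. The group relations below hold in the same way.
        P[I,0,0]≐𝟘 p = transᶜ (P-left-invariant [ -I , 0ℤ , 0ℤ ] [ -I , 0ℤ , 0ℤ ] P--I p) (P--I p)

        P[I,0,-1]≐𝟘 : P [ I , 0ℤ , -1ℤ ] ≐ 𝟘
        P[I,0,-1]≐𝟘 p =
          transᶜ (symᶜ (P-left-invariant [ I , 0ℤ , 1ℤ ] [ I , 0ℤ , -1ℤ ] P-01 p)) (P[I,0,0]≐𝟘 p)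

        -- The row vector (0, 1) times `T` is (1, 0), so [I, (0, 1)] [T, 0] = [T, (1, 0)].
        P[T,1,0]≐P-T : P [ T , 1ℤ , 0ℤ ] ≐ P-T
        P[T,1,0]≐P-T = P-left-invariant [ I , 0ℤ , 1ℤ ] [ T , 0ℤ , 0ℤ ] P-01

        P[ST]≐P-T : P [ ST , 0ℤ , 0ℤ ] ≐ P-T
        P[ST]≐P-T = P-left-invariant [ S , 0ℤ , 0ℤ ] [ T , 0ℤ , 0ℤ ] P-S

        P[-I,1,0]≐h : P [ -I , 1ℤ , 0ℤ ] ≐ h
        P[-I,1,0]≐h = P-left-invariant [ -I , 0ℤ , 0ℤ ] [ I , 1ℤ , 0ℤ ] P--I

        -- This is T² = -I.
        T²-relation : P-T ⊕ P-T ∣[ Ω ] [ T , 0ℤ , 0ℤ ] ≐ 𝟘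
        T²-relation p = begin
          to P-T p +ᶜ to (P-T ∣[ Ω ] [ T , 0ℤ , 0ℤ ]) p     ≈⟨ +ᶜ-comm _ _ ⟩
          to (P-T ∣[ Ω ] [ T , 0ℤ , 0ℤ ]) p +ᶜ to P-T p     ≈⟨ P-cocycle [ T , 0ℤ , 0ℤ ] [ T , 0ℤ , 0ℤ ] p ⟨
          to (P [ -I , 0ℤ , 0ℤ ]) p                         ≈⟨ P--I p ⟩
          0ᶜ                                                ∎

        -- This is (ST)³ = -I, expanded by two uses of the cocycle identity, with `P-T` standing for
        -- the period function of `ST`.
        [ST]³-relation :
          P-T ⊕ P-T ∣[ Ω ] [ ST , 0ℤ , 0ℤ ] ⊕ P-T ∣[ Ω ] [ ST ^ᴹ (+ 2) , 0ℤ , 0ℤ ] ≐ 𝟘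
        [ST]³-relation p = begin
          to P-T p +ᶜ to (P-T ∣[ Ω ] σ) p +ᶜ to (P-T ∣[ Ω ] σ²) p
            ≈⟨ solve 3 (λ x y z → x :+ y :+ z := z :+ (y :+ x)) reflᶜ _ _ _ ⟩
          to (P-T ∣[ Ω ] σ²) p +ᶜ (to (P-T ∣[ Ω ] σ) p +ᶜ to P-T p)
            ≈⟨ +ᶜ-cong (∣-cong Ω {P σ} {P-T} σ² P[ST]≐P-T p)
                 (+ᶜ-cong (∣-cong Ω {P σ} {P-T} σ P[ST]≐P-T p) (P[ST]≐P-T p)) ⟨
          to (P σ ∣[ Ω ] σ²) p +ᶜ (to (P σ ∣[ Ω ] σ) p +ᶜ to (P σ) p)
            -- The power `ST ^ᴹ (+ 2)` unfolds with a trailing factor `I`, yet evaluates to the same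
            -- entries as `ST ∙ ST`.
            ≈⟨ +ᶜ-cong reflᶜ (P-cocycle σ σ p) ⟨
          to (P σ ∣[ Ω ] σ²) p +ᶜ to (P σ²) p
            ≈⟨ P-cocycle σ σ² p ⟨
          to (P [ -I , 0ℤ , 0ℤ ]) p
            ≈⟨ P--I p ⟩
          0ᶜ ∎
          where
          open ℂ-Solver using (solve; _:+_; _:=_)
          σ σ² : Γᴶ
          σ  = [ ST , 0ℤ , 0ℤ ]
          σ² = [ ST ^ᴹ (+ 2) , 0ℤ , 0ℤ ]

        -- [I, (1, 0)] [T, 0] = [T, (0, -1)] = [T, 0] [I, (0, -1)].
        h∣T-relation : h ∣[ Ω ] [ T , 0ℤ , 0ℤ ] ≐ (⊝ P-T) ⊕ P-T ∣[ Ω ] [ I , 0ℤ , -1ℤ ]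
        h∣T-relation p = begin
          x                       ≈⟨ x+y-x≈y y x ⟨
          y +ᶜ x +ᶜ -ᶜ y          ≈⟨ +ᶜ-cong (+ᶜ-comm y x) reflᶜ ⟩
          x +ᶜ y +ᶜ -ᶜ y          ≈⟨ +ᶜ-cong x+y≈u reflᶜ ⟩
          u +ᶜ -ᶜ y               ≈⟨ +ᶜ-comm u _ ⟩
          -ᶜ y +ᶜ u               ∎
          where
          x y u : ℂ
          x = to (h ∣[ Ω ] [ T , 0ℤ , 0ℤ ]) p
          y = to P-T p
          u = to (P-T ∣[ Ω ] [ I , 0ℤ , -1ℤ ]) p
          x+y≈u : x +ᶜ y ≈ᶜ u
          x+y≈u = begin
            x +ᶜ y                                ≈⟨ P-cocycle [ I , 1ℤ , 0ℤ ] [ T , 0ℤ , 0ℤ ] p ⟨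
            to (P [ T , 0ℤ , -1ℤ ]) p             ≈⟨ P-cocycle [ T , 0ℤ , 0ℤ ] [ I , 0ℤ , -1ℤ ] p ⟩
            u +ᶜ to (P [ I , 0ℤ , -1ℤ ]) p        ≈⟨ +ᶜ-cong reflᶜ (P[I,0,-1]≐𝟘 p) ⟩
            u +ᶜ 0ᶜ                               ≈⟨ +ᶜ-identityʳ u ⟩
            u                                     ∎

        -- [-I, 0] [T, (1, 0)] = [-T, (1, 0)] = [T, 0] [-I, (1, 0)].
        h-as-coboundary : h ≐ P-T ⊕ (⊝ (P-T ∣[ Ω ] [ -I , 1ℤ , 0ℤ ]))
        h-as-coboundary p = begin
          x                       ≈⟨ x+y-x≈y u x ⟨
          u +ᶜ x +ᶜ -ᶜ u          ≈⟨ +ᶜ-cong u+x≈y reflᶜ ⟩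
          y +ᶜ -ᶜ u               ∎
          where
          x y u : ℂ
          x = to h p
          y = to P-T p
          u = to (P-T ∣[ Ω ] [ -I , 1ℤ , 0ℤ ]) p
          u+x≈y : u +ᶜ x ≈ᶜ y
          u+x≈y = begin
            u +ᶜ x                                ≈⟨ +ᶜ-cong reflᶜ (P[-I,1,0]≐h p) ⟨
            u +ᶜ to (P [ -I , 1ℤ , 0ℤ ]) p        ≈⟨ P-cocycle [ T , 0ℤ , 0ℤ ] [ -I , 1ℤ , 0ℤ ] p ⟨
            to (P [ -I ∙ T , 1ℤ , 0ℤ ]) p         ≈⟨ P-left-invariant [ -I , 0ℤ , 0ℤ ] [ T , 1ℤ , 0ℤ ] P--I p ⟩
            to (P [ T , 1ℤ , 0ℤ ]) p              ≈⟨ P[T,1,0]≐P-T p ⟩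
            y                                     ∎

        -- The factor -I sends (1, 0) to (-1, 0), which the second translation cancels: [I, (1, 0)]
        -- [-I, (1, 0)] = [-I, 0].
        h-involution : h ⊕ h ∣[ Ω ] [ -I , 1ℤ , 0ℤ ] ≐ 𝟘
        h-involution p = begin
          to h p +ᶜ u                             ≈⟨ +ᶜ-comm _ u ⟩
          u +ᶜ to h p                             ≈⟨ +ᶜ-cong reflᶜ (P[-I,1,0]≐h p) ⟨
          u +ᶜ to (P [ -I , 1ℤ , 0ℤ ]) p          ≈⟨ P-cocycle [ I , 1ℤ , 0ℤ ] [ -I , 1ℤ , 0ℤ ] p ⟨
          to (P [ -I , 0ℤ , 0ℤ ]) p               ≈⟨ P--I p ⟩
          0ᶜ                                      ∎
          where
          u : ℂ
          u = to (h ∣[ Ω ] [ -I , 1ℤ , 0ℤ ]) p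

theorem4p6 :
  ∀ {c ℓ₁ ℓ₂} (R : RealField c ℓ₁ ℓ₂) (B : RealAnalysis.LogBranch R) →
  let open RealAnalysis R
      open JacobiForms R B
  in
  (k m : ℝ) → HalfInteger k → HalfInteger m →
  (Ω : MultiplierSystem k m) →
  ω Ω [ -I , 0ℤ , 0ℤ ] ≈ᶜ 1ᶜ →
  (J : JacobiIntegral Ω) →
  let open JacobiIntegral J
      h   = P [ I , 1ℤ , 0ℤ ]
      P-T = P [ T , 0ℤ , 0ℤ ]
      ST  = S ∙ T
  in
  P [ S , 0ℤ , 0ℤ ] ≐ 𝟘 →
  P [ -I , 0ℤ , 0ℤ ] ≐ 𝟘 →
  P [ I , 0ℤ , 1ℤ ] ≐ 𝟘 →
  (P [ T , 1ℤ , 0ℤ ] ≐ P-T)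
  × (P-T ⊕ P-T ∣[ Ω ] [ T , 0ℤ , 0ℤ ] ≐ 𝟘)
  × (P-T ⊕ P-T ∣[ Ω ] [ ST , 0ℤ , 0ℤ ] ⊕ P-T ∣[ Ω ] [ ST ^ᴹ (+ 2) , 0ℤ , 0ℤ ] ≐ 𝟘)
  × (h ∣[ Ω ] [ T , 0ℤ , 0ℤ ] ≐ (⊝ P-T) ⊕ P-T ∣[ Ω ] [ I , 0ℤ , -1ℤ ])
  × (h ≐ P-T ⊕ (⊝ (P-T ∣[ Ω ] [ -I , 1ℤ , 0ℤ ])))
  × (h ⊕ h ∣[ Ω ] [ -I , 1ℤ , 0ℤ ] ≐ 𝟘)
theorem4p6 R B _ _ _ _ _ _ J P-S P--I P-01 =
    P[T,1,0]≐P-T P-S P--I P-01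
  , T²-relation P-S P--I P-01
  , [ST]³-relation P-S P--I P-01
  , h∣T-relation P-S P--I P-01
  , h-as-coboundary P-S P--I P-01
  , h-involution P-S P--I P-01
  where open SlashAction.PeriodRelations R B J
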